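{- There are absolute constants $c>0$ and $C>0$ such that the following holds. Let $n,N$ be positive integers with $N\le n\cdot2^{c\log^*(n)}$ and let $A:[n]\times[n]\to[N]$ be a linjection. Then $$\alpha_3(A)\ \le\ C\,\frac{n^2}{2^{c\log^*(n)}} .$$
   Context: $[n]=\{1,\dots,n\}$; $\log^*$ is the iterated logarithm (base 2). A linjection $A:[n]\times[n]\to[N]$ (with $N\ge n$) is a map that is injective on every row $\{x\}\times[n]$ and every column $[n]\times\{y\}$. It corresponds to the function $f:[n]\times[n]\times[N]\to\{0,1\}$ with $f(x,y,b)=1\iff A(x,y)=b$. In $X_1\times X_2\times X_3=[n]\times[n]\times[N]$, a cylinder in dimension $i$ is a subset closed under arbitrary changes of the $i$-th coordinate, and a cylinder intersection is a set $T_1\cap T_2\cap T_3$ with $T_i$ a cylinder in dimension $i$. $\alpha_3(A)=\alpha_3(f)$ is the largest cardinality of a cylinder intersection contained in $f^{ -1}(1)$. -}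

module Defs where

open import Algebra.Definitions.RawSemiring using (_^_)
open import Data.Bool using (Bool; true; _≟_)
open import Data.Fin using (Fin; combine)
open import Data.Fin.Properties as Fin using (all?)
open import Data.Fin.Subset using (Subset; inside; outside; _∈_; _∩_; ∣_∣)
open import Data.Fin.Subset.Properties using (anySubset?; _∈?_)
open import Data.Integer as ℤ using (+_)
open import Data.List using (List; []; _∷_; _++_; map; filter)
open import Data.List.Extrema.Nat using (max)
open import Data.Nat as ℕ using (ℕ; zero; suc; _≤_; _<_; z<s; s<s)
open import Data.Nat.Induction using (<-wellFounded)
open import Data.Nat.Logarithm using (⌈log₂_⌉; ⌈log₂⌉-mono-≤; ⌈log₂2^n⌉≡n)
open import Data.Nat.Properties as ℕ using (module ≤-Reasoning)
open import Data.Product using (∃-syntax; _×_)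
open import Data.Rational as ℚ using (ℚ; ↥_; ↧ₙ_; +-*-rawSemiring)
open import Data.Vec using ([]; _∷_)
open import Data.Vec.Properties using (≡-dec)
open import Function using (Injective)
open import Induction.WellFounded using (Acc; acc)
open import Relation.Binary.PropositionalEquality using (_≡_)
open import Relation.Nullary using (Dec; does; _×-dec_; _→-dec_)

private
  variable
    n N : ℕ

record Linjection (n N : ℕ) : Set where
  field
    n≤N           : n ≤ N
    to            : Fin n → Fin n → Fin N
    row-injective : ∀ x → Injective _≡_ _≡_ (λ y → to x y)
    col-injective : ∀ y → Injective _≡_ _≡_ (λ x → to x y)

-- The values 0 and 1 are `false` and `true`.
graph : Linjection n N → Fin n → Fin n → Fin N → Bool
graph A x y b = does (Linjection.to A x y Fin.≟ b)

subsets : ∀ n → List (Subset n)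
subsets zero    = [] ∷ []
subsets (suc n) = map (outside ∷_) (subsets n) ++ map (inside ∷_) (subsets n)

-- Subsets of Fin k × Fin l × Fin m are represented as `Subset (k * (l * m))`
-- along the bijection `cell`.
module Box (k l m : ℕ) where

  Subset₃ : Set
  Subset₃ = Subset (k ℕ.* (l ℕ.* m))

  cell : Fin k → Fin l → Fin m → Fin (k ℕ.* (l ℕ.* m))
  cell x y b = combine x (combine y b)

  IsCylinder₁ IsCylinder₂ IsCylinder₃ : Subset₃ → Set
  IsCylinder₁ T = ∀ x x′ y b → cell x y b ∈ T → cell x′ y b ∈ T
  IsCylinder₂ T = ∀ x y y′ b → cell x y b ∈ T → cell x y′ b ∈ T
  IsCylinder₃ T = ∀ x y b b′ → cell x y b ∈ T → cell x y b′ ∈ T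

  IsCylinderIntersection : Subset₃ → Set
  IsCylinderIntersection S =
    ∃[ T₁ ] ∃[ T₂ ] ∃[ T₃ ]
      IsCylinder₁ T₁ × IsCylinder₂ T₂ × IsCylinder₃ T₃ × S ≡ T₁ ∩ T₂ ∩ T₃

  _⊆f⁻¹1[_] : Subset₃ → (Fin k → Fin l → Fin m → Bool) → Set
  S ⊆f⁻¹1[ f ] = ∀ x y b → cell x y b ∈ S → f x y b ≡ true

  isCylinder₁? : ∀ T → Dec (IsCylinder₁ T)
  isCylinder₁? T = all? λ x → all? λ x′ → all? λ y → all? λ b →
    (cell x y b ∈? T) →-dec (cell x′ y b ∈? T)

  isCylinder₂? : ∀ T → Dec (IsCylinder₂ T)
  isCylinder₂? T = all? λ x → all? λ y → all? λ y′ → all? λ b →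
    (cell x y b ∈? T) →-dec (cell x y′ b ∈? T)

  isCylinder₃? : ∀ T → Dec (IsCylinder₃ T)
  isCylinder₃? T = all? λ x → all? λ y → all? λ b → all? λ b′ →
    (cell x y b ∈? T) →-dec (cell x y b′ ∈? T)

  isCylinderIntersection? : ∀ S → Dec (IsCylinderIntersection S)
  isCylinderIntersection? S =
    anySubset? λ T₁ → anySubset? λ T₂ → anySubset? λ T₃ →
      isCylinder₁? T₁ ×-dec isCylinder₂? T₂ ×-dec isCylinder₃? T₃ ×-dec
      ≡-dec _≟_ S (T₁ ∩ T₂ ∩ T₃)

  _⊆f⁻¹1?[_] : ∀ S f → Dec (S ⊆f⁻¹1[ f ])
  S ⊆f⁻¹1?[ f ] = all? λ x → all? λ y → all? λ b →
    (cell x y b ∈? S) →-dec (f x y b ≟ true)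

  admissible? : ∀ f S → Dec (IsCylinderIntersection S × S ⊆f⁻¹1[ f ])
  admissible? f S = isCylinderIntersection? S ×-dec (S ⊆f⁻¹1?[ f ])

  -- The default value 0 of `max` is harmless: the empty set is a cylinder
  -- intersection contained in f⁻¹(1).
  α₃ᶠ : (Fin k → Fin l → Fin m → Bool) → ℕ
  α₃ᶠ f = max 0 (map ∣_∣ (filter (admissible? f) (subsets _)))

α₃ : Linjection n N → ℕ
α₃ {n} {N} A = Box.α₃ᶠ n n N (graph A)

⌈log₂⌉-< : ∀ n → ⌈log₂ 2 ℕ.+ n ⌉ < 2 ℕ.+ n
⌈log₂⌉-< n = ℕ.s≤s (begin
  ⌈log₂ 2 ℕ.+ n ⌉          ≤⟨ ⌈log₂⌉-mono-≤ (n<2^n (suc n)) ⟩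
  ⌈log₂ (2 ℕ.^ (suc n)) ⌉  ≡⟨ ⌈log₂2^n⌉≡n (suc n) ⟩
  suc n                    ∎)
  where
  open ≤-Reasoning
  n<2^n : ∀ n → n < 2 ℕ.^ n
  n<2^n zero    = z<s
  n<2^n (suc n) = ℕ.≤-trans (s<s (n<2^n n))
    (ℕ.+-mono-≤ (ℕ.m^n>0 2 n) (ℕ.m≤m+n (2 ℕ.^ n) 0))

-- The number of times x ↦ log₂ x must be applied to n before the result is at
-- most 1.  Rounding every logarithm up does not change this number: it is at
-- most k exactly when n is at most the tower of 2s of height k (height 0 being
-- 1), and these towers are integers.
log*-acc : ∀ n → Acc _<_ n → ℕ
log*-acc 0             _         = 0
log*-acc 1             _         = 0
log*-acc (suc (suc n)) (acc rec) =
  suc (log*-acc ⌈log₂ 2 ℕ.+ n ⌉ (rec (⌈log₂⌉-< n)))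

log* : ℕ → ℕ
log* n = log*-acc n (<-wellFounded n)

fromℕ : ℕ → ℚ
fromℕ n = + n ℚ./ 1

_^ℚ_ : ℚ → ℕ → ℚ
_^ℚ_ = _^_ +-*-rawSemiring

infixr 8 _^ℚ_
infix  4 _≤_·2^[_·_] _≤_/2^[_·_]

-- The inequalities x ≤ y · 2^(c·j) and x ≤ y / 2^(c·j) between real numbers,
-- for rationals x, y, c ≥ 0.  Writing c = p/q in lowest terms, both sides are
-- raised to the q-th power, which is strictly increasing on nonnegative reals
-- and turns 2^(c·j) into 2^(p·j).
_≤_·2^[_·_] : ℚ → ℚ → ℚ → ℕ → Set
x ≤ y ·2^[ c · j ] =
  x ^ℚ ↧ₙ c ℚ.≤ y ^ℚ ↧ₙ c ℚ.* fromℕ (2 ℕ.^ (ℤ.∣ ↥ c ∣ ℕ.* j))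

_≤_/2^[_·_] : ℚ → ℚ → ℚ → ℕ → Set
x ≤ y /2^[ c · j ] =
  x ^ℚ ↧ₙ c ℚ.* fromℕ (2 ℕ.^ (ℤ.∣ ↥ c ∣ ℕ.* j)) ℚ.≤ y ^ℚ ↧ₙ c

{-# OPTIONS --safe #-}
module Submission where

-- A cylinder intersection inside the graph of A is a tripartite graph on
-- [n] ⊎ [n] ⊎ [N] each of whose edges lies in exactly one triangle, so the claim
-- is Fox's quantitative form of the Ruzsa–Szemerédi theorem.  Partition the three
-- vertex sets.  In every triple of not too small cells, one of the three pairs of
-- cells contains a positive proportion of pairs that is a union of boundedly many
-- rectangles and nearly free of edges.  Refining the partition along these
-- rectangles lowers an entropy of the edge densities by a constant per triangle,
-- while the number of cells grows at most doubly exponentially.  As the entropy is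
-- at most O(log (n²/m)) per triangle, where m is the number of triangles,
-- O(log (n²/m)) refinements suffice, and they are possible unless log* n is
-- O(log (n²/m)).

open import Defs
open import Data.Product using (∃-syntax; _×_; _,_)
open import Relation.Binary.PropositionalEquality using (_≡_; cong; subst; subst₂; sym; trans; refl)

-- The number of refinements must be linear in the logarithm of the inverse density. A mean-square
-- potential would ask for polynomially many in the inverse density, and then only a power of
-- `log* n` would be saved. Entropy does better: when a fixed proportion of a cell is nearly free of
-- edges, its edges sit on pairs that are denser by a constant factor, which is worth a constant per
-- edge however sparse the cell is.
--
-- Logarithms are avoided altogether. As a function of the density, the entropy is up to rounding
-- the lower envelope of the lines of slope `(K - k) * 2 ^ K` and intercept `2 ^ k`, and the label
-- of a cell selects one of them. Labels are carried along instead of being optimised and change by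
-- at most one in a refinement, so every estimate is a linear inequality between natural numbers.

module Combinatorics where

  open import Algebra.Properties.Semiring.Sum as ∑ using ()
  open import Data.Bool using (Bool; true; false; _∧_; _∨_; not; if_then_else_)
  open import Data.Fin as Fin
    using (Fin; zero; suc; toℕ; fromℕ<; inject≤; combine; quotient; remainder; funToFin; finToFun; _↑ˡ_; _↑ʳ_)
  open import Data.Fin.Properties as Fin
    using (any?; remQuot-combine; toℕ-inject≤; toℕ<n; toℕ-fromℕ<; finToFun-funToFin)
  open import Data.Fin.Subset using (Subset; _∈_; _∩_; ∣_∣; inside; outside)
  open import Data.Fin.Subset.Properties using (x∈p∩q⁺; x∈p∩q⁻)
  open import Data.List.Extrema.Nat using (argmax-all)
  open import Data.List.Relation.Unary.All as All using ()
  open import Data.List.Relation.Unary.All.Properties using (map⁺; all-filter)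
  open import Data.Maybe using (Maybe; just; nothing; is-just)
  open import Data.Nat
  open import Data.Nat.DivMod using (m≡m%n+[m/n]*n; m%n<n; m/n*n≤m)
  open import Data.Nat.Induction using (<-wellFounded)
  open import Data.Nat.Logarithm using (⌈log₂_⌉; ⌈log₂⌉-mono-≤; ⌈log₂2^n⌉≡n)
  open import Data.Nat.Properties
  open import Data.Nat.Tactic.RingSolver using (solve-∀)
  open import Data.Product using (proj₁; proj₂)
  open import Data.Sum using (_⊎_; inj₁; inj₂)
  open import Data.Vec using ([]; _∷_; lookup)
  open import Data.Vec.Properties using ([]=⇒lookup; lookup⇒[]=)
  open import Function using (_∘_)
  open import Induction.WellFounded using (Acc; acc)
  open import Relation.Binary.PropositionalEquality using (cong₂; module ≡-Reasoning)
  open import Relation.Nullary using (yes; no; contradiction; does; ofʸ; ofⁿ)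
  open import Relation.Nullary.Decidable using (dec-true)

  open ∑ +-*-semiring using (sum; sum-cong-≗; ∑-comm; ∑-distrib-+; *-distribˡ-sum; *-distribʳ-sum)

  private
    variable
      a b : ℕ

  -- Indicators and weighted sums over finite sets.

  ⟦_⟧ : Bool → ℕ
  ⟦ true ⟧  = 1
  ⟦ false ⟧ = 0

  ⟦⟧≤1 : ∀ p → ⟦ p ⟧ ≤ 1
  ⟦⟧≤1 true  = ≤-refl
  ⟦⟧≤1 false = z≤n

  -- Farkas' lemma as a proof rule: l ≤ r is a combination of the hypotheses, s the
  -- slack, and the remaining identity is left to the ring solver.
  linear : ∀ {l r x y} s → l ≤ r → x + r + s ≡ y + l → x ≤ y
  linear {l} {r} {x} {y} s l≤r eq = +-cancelʳ-≤ r x y (begin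
    x + r      ≤⟨ m≤m+n _ s ⟩
    x + r + s  ≡⟨ eq ⟩
    y + l      ≤⟨ +-monoʳ-≤ y l≤r ⟩
    y + r      ∎)
    where open ≤-Reasoning

  sum-mono : {f g : Fin a → ℕ} → (∀ x → f x ≤ g x) → sum f ≤ sum g
  sum-mono {zero}  f≤g = z≤n
  sum-mono {suc a} f≤g = +-mono-≤ (f≤g zero) (sum-mono (f≤g ∘ suc))

  sum-const : ∀ a k → sum {a} (λ _ → k) ≡ a * k
  sum-const zero    k = refl
  sum-const (suc a) k = cong (k +_) (sum-const a k)

  𝟙 : Fin a → ℕ
  𝟙 _ = 1

  sum-𝟙 : ∀ n → sum {n} 𝟙 ≡ n
  sum-𝟙 n = trans (sum-const n 1) (*-identityʳ n)

  fibre : ∀ {T} → (Fin a → Fin T) → Fin T → Fin a → ℕ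
  fibre φ i x = ⟦ does (φ x Fin.≟ i) ⟧

  sum-δ : ∀ {T} (k : Fin T) (f : Fin T → ℕ) → sum (λ i → ⟦ does (k Fin.≟ i) ⟧ * f i) ≡ f k
  sum-δ {suc T} zero    f = begin
    f zero + 0 + sum {T} (λ _ → 0)  ≡⟨ cong₂ _+_ (+-identityʳ (f zero)) (sum-const T 0) ⟩
    f zero + T * 0                  ≡⟨ cong (f zero +_) (*-zeroʳ T) ⟩
    f zero + 0                      ≡⟨ +-identityʳ (f zero) ⟩
    f zero                          ∎
    where open ≡-Reasoning
  sum-δ {suc T} (suc k) f = sum-δ k (f ∘ suc)

  opaque
    -- The weight is typically `𝟙` or the indicator `fibre φ i` of a cell, so that passing to a cell
    -- changes the measure and not the vertex set.
    ∫ : (Fin a → ℕ) → (Fin a → ℕ) → ℕ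
    ∫ p f = sum λ x → p x * f x

    ∫-cong : (p : Fin a → ℕ) {f g : Fin a → ℕ} → (∀ x → f x ≡ g x) → ∫ p f ≡ ∫ p g
    ∫-cong p f≗g = sum-cong-≗ λ x → cong (p x *_) (f≗g x)

    ∫-mono : (p : Fin a → ℕ) {f g : Fin a → ℕ} → (∀ x → f x ≤ g x) → ∫ p f ≤ ∫ p g
    ∫-mono p f≤g = sum-mono λ x → *-monoʳ-≤ (p x) (f≤g x)

    ∫-+ : ∀ (p : Fin a → ℕ) f g → ∫ p (λ x → f x + g x) ≡ ∫ p f + ∫ p g
    ∫-+ p f g = trans (sum-cong-≗ λ x → *-distribˡ-+ (p x) (f x) (g x))
                      (∑-distrib-+ (λ x → p x * f x) (λ x → p x * g x))

    ∫-* : ∀ (p : Fin a → ℕ) k f → ∫ p (λ x → k * f x) ≡ k * ∫ p f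
    ∫-* p k f = trans (sum-cong-≗ λ x → swap (p x) k (f x))
                      (sym (*-distribˡ-sum k (λ x → p x * f x)))
      where
      swap : ∀ u v w → u * (v * w) ≡ v * (u * w)
      swap = solve-∀

    ∫-const : ∀ (p : Fin a → ℕ) k → ∫ p (λ _ → k) ≡ sum p * k
    ∫-const p k = sym (*-distribʳ-sum k p)

    ∫-comm : ∀ (p : Fin a → ℕ) (q : Fin b → ℕ) (F : Fin a → Fin b → ℕ) →
             ∫ p (λ x → ∫ q (F x)) ≡ ∫ q (λ y → ∫ p (λ x → F x y))
    ∫-comm p q F = begin
      sum (λ x → p x * ∫ q (F x))                ≡⟨ sum-cong-≗ (λ x → sym (∫-* q (p x) (F x))) ⟩
      sum (λ x → sum λ y → q y * (p x * F x y))  ≡⟨ ∑-comm (λ x y → q y * (p x * F x y)) ⟩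
      sum (λ y → sum λ x → q y * (p x * F x y))  ≡⟨ sum-cong-≗ (λ y → sym (*-distribˡ-sum (q y) (λ x → p x * F x y))) ⟩
      ∫ q (λ y → ∫ p (λ x → F x y))              ∎
      where open ≡-Reasoning

    ∫-≤-sum : ∀ (p : Fin a → ℕ) f → (∀ x → p x ≤ 1) → ∫ p f ≤ sum f
    ∫-≤-sum p f p≤1 = sum-mono λ x → ≤-trans (*-monoˡ-≤ (f x) (p≤1 x)) (≤-reflexive (*-identityˡ (f x)))

    ∫-𝟙 : ∀ (f : Fin a → ℕ) → ∫ 𝟙 f ≡ sum f
    ∫-𝟙 f = sum-cong-≗ λ x → *-identityˡ (f x)

    ∫-sum : ∀ {T} (p : Fin a → ℕ) (F : Fin T → Fin a → ℕ) →
            sum (λ j → ∫ p (F j)) ≡ ∫ p (λ x → sum λ j → F j x)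
    ∫-sum p F = trans (∑-comm (λ j x → p x * F j x))
      (sum-cong-≗ λ x → sym (*-distribˡ-sum (p x) (λ j → F j x)))

    sum-fibre : ∀ {T} (φ : Fin a → Fin T) (F : Fin T → Fin a → ℕ) →
                sum (λ i → ∫ (fibre φ i) (F i)) ≡ ∫ 𝟙 (λ x → F (φ x) x)
    sum-fibre φ F = trans (∑-comm (λ i x → fibre φ i x * F i x))
      (sum-cong-≗ λ x → trans (sum-δ (φ x) (λ i → F i x)) (sym (*-identityˡ (F (φ x) x))))

  ∬ : (Fin a → ℕ) → (Fin b → ℕ) → (Fin a → Fin b → ℕ) → ℕ
  ∬ p q F = ∫ p λ x → ∫ q (F x)

  ∬-cong : ∀ (p : Fin a → ℕ) (q : Fin b → ℕ) {F G} → (∀ x y → F x y ≡ G x y) → ∬ p q F ≡ ∬ p q G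
  ∬-cong p q F≗G = ∫-cong p λ x → ∫-cong q (F≗G x)

  ∬-mono : ∀ (p : Fin a → ℕ) (q : Fin b → ℕ) {F G} → (∀ x y → F x y ≤ G x y) → ∬ p q F ≤ ∬ p q G
  ∬-mono p q F≤G = ∫-mono p λ x → ∫-mono q (F≤G x)

  ∬-+ : ∀ (p : Fin a → ℕ) (q : Fin b → ℕ) F G →
        ∬ p q (λ x y → F x y + G x y) ≡ ∬ p q F + ∬ p q G
  ∬-+ p q F G = trans (∫-cong p λ x → ∫-+ q (F x) (G x)) (∫-+ p _ _)

  ∬-* : ∀ (p : Fin a → ℕ) (q : Fin b → ℕ) k F → ∬ p q (λ x y → k * F x y) ≡ k * ∬ p q F
  ∬-* p q k F = trans (∫-cong p λ x → ∫-* q k (F x)) (∫-* p k _)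

  ∬-const : ∀ (p : Fin a → ℕ) (q : Fin b → ℕ) k → ∬ p q (λ _ _ → k) ≡ sum p * sum q * k
  ∬-const p q k = trans (∫-cong p λ _ → ∫-const q k)
    (trans (∫-const p (sum q * k)) (sym (*-assoc (sum p) (sum q) k)))

  ∬-⟦⟧≤ : ∀ (p : Fin a → ℕ) (q : Fin b → ℕ) (U : Fin a → Fin b → Bool) →
          ∬ p q (λ x y → ⟦ U x y ⟧) ≤ sum p * sum q
  ∬-⟦⟧≤ p q U = ≤-trans (∬-mono p q λ x y → ⟦⟧≤1 (U x y))
    (≤-reflexive (trans (∬-const p q 1) (*-identityʳ _)))

  -- Sets of pairs of bounded complexity.

  record Simple {a b} (S : ℕ) (U : Fin a → Fin b → Bool) : Set where
    field
      row  : Fin a → Fin S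
      col  : Fin b → Fin S
      cell : Fin S → Fin S → Bool
      fits : ∀ x y → U x y ≡ cell (row x) (col y)

  simple-weaken : ∀ {S S′} {U : Fin a → Fin b → Bool} → S ≤ S′ → Simple S U → Simple S′ U
  simple-weaken {S = S} {S′} {U} S≤S′ sU = record
    { row  = λ x → inject≤ (row x) S≤S′
    ; col  = λ y → inject≤ (col y) S≤S′
    ; cell = cell′
    ; fits = λ x y → trans (fits x y) (sym (cell′-inject (row x) (col y)))
    }
    where
    open Simple sU
    cell′ : Fin S′ → Fin S′ → Bool
    cell′ i j with toℕ i <? S | toℕ j <? S
    ... | yes i< | yes j< = cell (fromℕ< i<) (fromℕ< j<)
    -- The embedded classes all lie below `S`, so this default is never read.
    ... | _      | _      = false
    cell′-inject : ∀ i j → cell′ (inject≤ i S≤S′) (inject≤ j S≤S′) ≡ cell i j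
    cell′-inject i j with toℕ (inject≤ i S≤S′) <? S | toℕ (inject≤ j S≤S′) <? S
    ... | yes i< | yes j< = cong₂ cell (restrict i i<) (restrict j j<)
      where
      restrict : ∀ i (i< : toℕ (inject≤ i S≤S′) < S) → fromℕ< i< ≡ i
      restrict i i< = Fin.toℕ-injective (trans (toℕ-fromℕ< i<) (toℕ-inject≤ i S≤S′))
    ... | no i≮  | _      = contradiction (subst (_< S) (sym (toℕ-inject≤ i S≤S′)) (toℕ<n i)) i≮
    ... | yes _  | no j≮  = contradiction (subst (_< S) (sym (toℕ-inject≤ j S≤S′)) (toℕ<n j)) j≮

  simple-∅ : Simple {a} {b} 1 (λ _ _ → false)
  simple-∅ = record { row = λ _ → zero ; col = λ _ → zero ; cell = λ _ _ → false ; fits = λ _ _ → refl }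

  bit : Bool → Fin 2
  bit true  = suc zero
  bit false = zero

  unbit : Fin 2 → Bool
  unbit zero    = false
  unbit (suc _) = true

  unbit-bit : ∀ p → unbit (bit p) ≡ p
  unbit-bit true  = refl
  unbit-bit false = refl

  quotient-combine : ∀ {m n} (i : Fin m) (j : Fin n) → quotient n (combine i j) ≡ i
  quotient-combine i j = cong proj₁ (remQuot-combine i j)

  remainder-combine : ∀ {m n} (i : Fin m) (j : Fin n) → remainder {m} n (combine i j) ≡ j
  remainder-combine i j = cong proj₂ (remQuot-combine i j)

  -- Membership in `A` or `B` adds one bit to each class. Classes are counted rather than rectangles
  -- because splitting both sides into their classes is what makes the set constant on every new
  -- pair of cells.
  simple-∪-rectangle : ∀ {S} {U : Fin a → Fin b → Bool} (A : Fin a → Bool) (B : Fin b → Bool) →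
    Simple S U → Simple (2 * S) (λ x y → U x y ∨ (A x ∧ B y))
  simple-∪-rectangle {S = S} {U} A B sU = record
    { row  = λ x → combine (bit (A x)) (row x)
    ; col  = λ y → combine (bit (B y)) (col y)
    ; cell = λ i j → cell (remainder {2} S i) (remainder {2} S j)
                     ∨ (unbit (quotient S i) ∧ unbit (quotient S j))
    ; fits = λ x y → sym (cong₂ _∨_
        (trans (cong₂ cell (remainder-combine (bit (A x)) (row x)) (remainder-combine (bit (B y)) (col y)))
               (sym (fits x y)))
        (cong₂ _∧_ (decode (A x) (row x)) (decode (B y) (col y))))
    }
    where
    open Simple sU
    decode : ∀ p i → unbit (quotient S (combine (bit p) i)) ≡ p
    decode p i = trans (cong unbit (quotient-combine (bit p) i)) (unbit-bit p)

  -- Greedy unions of light rectangles.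

  module Greedy {a b ι} (p : Fin a → ℕ) (q : Fin b → ℕ) (w : Fin a → Fin b → ℕ) (D : ℕ)
    (A : Fin ι → Fin a → Bool) (B : Fin ι → Fin b → Bool)
    (light : ∀ i → D * ∬ p q (λ x y → w x y * ⟦ A i x ∧ B i y ⟧) ≤ sum p * sum q)
    where

    fresh : (Fin a → Fin b → Bool) → Fin ι → ℕ
    fresh U i = ∬ p q λ x y → ⟦ (A i x ∧ B i y) ∧ not (U x y) ⟧

    private
      s : ℕ
      s = sum p * sum q

      μ ν : (Fin a → Fin b → Bool) → ℕ
      μ U = ∬ p q λ x y → ⟦ U x y ⟧
      ν U = ∬ p q λ x y → w x y * ⟦ U x y ⟧

      add : (Fin a → Fin b → Bool) → Fin ι → Fin a → Fin b → Bool
      add U i x y = U x y ∨ (A i x ∧ B i y)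

      μ-add : ∀ U i → μ (add U i) ≡ μ U + fresh U i
      μ-add U i = trans (∬-cong p q λ x y → pointwise (U x y) (A i x ∧ B i y)) (∬-+ p q _ _)
        where
        pointwise : ∀ u f → ⟦ u ∨ f ⟧ ≡ ⟦ u ⟧ + ⟦ f ∧ not u ⟧
        pointwise true  true  = refl
        pointwise true  false = refl
        pointwise false true  = refl
        pointwise false false = refl

      ν-add : ∀ U i → ν (add U i) ≤ ν U + ν (λ x y → A i x ∧ B i y)
      ν-add U i = ≤-trans (∬-mono p q λ x y → pointwise (w x y) (U x y) (A i x ∧ B i y))
                          (≤-reflexive (∬-+ p q _ _))
        where
        pointwise : ∀ k u f → k * ⟦ u ∨ f ⟧ ≤ k * ⟦ u ⟧ + k * ⟦ f ⟧
        pointwise k true  f = m≤m+n _ _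
        pointwise k false f = m≤n+m _ _

      -- The invariant after `k` rounds. A round adds a rectangle only if it brings more than
      -- `s / D` fresh pairs, while its weight is at most `s / D`. Hence either the process has
      -- stopped or the area has reached `k * s / D`.
      Stage : ℕ → Set
      Stage k = ∃[ U ] Simple (2 ^ k) U × D * ν U ≤ k * s ×
                ((∀ i → D * fresh U i ≤ s) ⊎ k * s ≤ D * μ U)

      stage : ∀ k → Stage k
      stage zero = (λ _ _ → false) , simple-∅ , ≤-reflexive (trans (cong (D *_) ν∅) (*-zeroʳ D)) , inj₂ z≤n
        where
        ν∅ : ν (λ _ _ → false) ≡ 0
        ν∅ = trans (∬-cong p q λ x y → *-zeroʳ (w x y)) (trans (∬-const p q 0) (*-zeroʳ s))
      stage (suc k) with stage k
      ... | U , sU , νU≤ , inj₁ done =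
        U , simple-weaken (^-monoʳ-≤ 2 (n≤1+n k)) sU , ≤-trans νU≤ (m≤n+m _ s) , inj₁ done
      ... | U , sU , νU≤ , inj₂ μU≥ with any? (λ i → s <? D * fresh U i)
      ...   | no none = U , simple-weaken (^-monoʳ-≤ 2 (n≤1+n k)) sU , ≤-trans νU≤ (m≤n+m _ s) ,
                        inj₁ λ i → ≮⇒≥ λ s< → none (i , s<)
      ...   | yes (i , s<) = add U i , simple-∪-rectangle (A i) (B i) sU , ν≤ , inj₂ μ≥
        where
        open ≤-Reasoning
        ν≤ : D * ν (add U i) ≤ s + k * s
        ν≤ = begin
          D * ν (add U i)                                ≤⟨ *-monoʳ-≤ D (ν-add U i) ⟩
          D * (ν U + ν (λ x y → A i x ∧ B i y))          ≡⟨ *-distribˡ-+ D (ν U) _ ⟩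
          D * ν U + D * ν (λ x y → A i x ∧ B i y)        ≤⟨ +-mono-≤ νU≤ (light i) ⟩
          k * s + s                                      ≡⟨ +-comm (k * s) s ⟩
          s + k * s                                      ∎
        μ≥ : s + k * s ≤ D * μ (add U i)
        μ≥ = begin
          s + k * s                    ≤⟨ +-mono-≤ (<⇒≤ s<) μU≥ ⟩
          D * fresh U i + D * μ U      ≡⟨ *-distribˡ-+ D (fresh U i) (μ U) ⟨
          D * (fresh U i + μ U)        ≡⟨ cong (D *_) (trans (+-comm _ (μ U)) (sym (μ-add U i))) ⟩
          D * μ (add U i)              ∎

    -- If the process has not stopped after `D` rounds, then `U` has full area and nothing fresh is
    -- left, so both outcomes yield the same conclusion.
    greedy : .{{NonZero D}} → ∃[ U ] Simple (2 ^ D) U × ν U ≤ s × (∀ i → D * fresh U i ≤ s)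
    greedy with stage D
    ... | U , sU , νU≤ , inj₁ done = U , sU , *-cancelˡ-≤ D νU≤ , done
    ... | U , sU , νU≤ , inj₂ μU≥  = U , sU , *-cancelˡ-≤ D νU≤ , λ i → ≤-trans (full i) z≤n
      where
      open ≤-Reasoning
      full : ∀ i → D * fresh U i ≤ 0
      full i = +-cancelʳ-≤ (D * μ U) _ 0 (begin
        D * fresh U i + D * μ U  ≡⟨ *-distribˡ-+ D (fresh U i) (μ U) ⟨
        D * (fresh U i + μ U)    ≡⟨ cong (D *_) (trans (+-comm _ (μ U)) (sym (μ-add U i))) ⟩
        D * μ (add U i)          ≤⟨ *-monoʳ-≤ D (∬-⟦⟧≤ p q (add U i)) ⟩
        D * s                    ≤⟨ μU≥ ⟩
        D * μ U                  ∎)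

  -- Shattered pairs of cells and the triangle lemma.

  record Shatter {a b} (S Θ : ℕ) (E : Fin a → Fin b → Bool) (p : Fin a → ℕ) (q : Fin b → ℕ) : Set where
    field
      part   : Fin a → Fin b → Bool
      simple : Simple S part
      large  : sum p * sum q ≤ 8 * ∬ p q (λ x y → ⟦ part x y ⟧)
      sparse : Θ * ∬ p q (λ x y → ⟦ E x y ⟧ * ⟦ part x y ⟧) ≤ sum p * sum q

  shatter-null : ∀ {S Θ} {E : Fin a → Fin b → Bool} (p : Fin a → ℕ) (q : Fin b → ℕ) →
                 1 ≤ S → sum p * sum q ≡ 0 → Shatter S Θ E p q
  shatter-null {Θ = Θ} {E} p q 1≤S null = record
    { part   = λ _ _ → false
    ; simple = simple-weaken 1≤S simple-∅
    ; large  = ≤-trans (≤-reflexive null) z≤n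
    ; sparse = ≤-trans (≤-reflexive (trans (cong (Θ *_) (trans (∬-cong p q λ x y → *-zeroʳ ⟦ E x y ⟧)
                   (trans (∬-const p q 0) (*-zeroʳ (sum p * sum q))))) (*-zeroʳ Θ))) z≤n
    }

  within-≤ : ∀ u s → ⟦ u ≤ᵇ s ⟧ * u ≤ s
  within-≤ u s with u ≤ᵇ s | ≤ᵇ-reflects-≤ u s
  ... | true  | ofʸ u≤s = ≤-trans (≤-reflexive (+-identityʳ u)) u≤s
  ... | false | _       = z≤n

  -- The pointwise form of Markov's inequality: integrated, it bounds the measure of the points
  -- where `u` exceeds `s`.
  within-> : ∀ u s → ⟦ not (u ≤ᵇ s) ⟧ * s ≤ u
  within-> u s with u ≤ᵇ s | ≤ᵇ-reflects-≤ u s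
  ... | true  | _       = z≤n
  ... | false | ofⁿ u≰s = ≤-trans (≤-reflexive (+-identityʳ s)) (≰⇒≥ u≰s)

  ⟦∧⟧ : ∀ p q → ⟦ p ∧ q ⟧ ≡ ⟦ p ⟧ * ⟦ q ⟧
  ⟦∧⟧ true  q = sym (+-identityʳ ⟦ q ⟧)
  ⟦∧⟧ false q = refl

  majority : ∀ (p : Fin a → ℕ) (g : Fin a → Bool) →
             2 * ∫ p (λ x → ⟦ not (g x) ⟧) ≤ sum p → sum p ≤ 2 * ∫ p (λ x → ⟦ g x ⟧)
  majority p g bad≤ = linear 0 bad≤
    (trans (double (sum p)) (trans (cong (2 *_) total) (*-distribˡ-+ 2 good bad)))
    where
    good bad : ℕ
    good = ∫ p (λ x → ⟦ g x ⟧)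
    bad  = ∫ p (λ x → ⟦ not (g x) ⟧)
    one : ∀ u → 1 ≡ ⟦ u ⟧ + ⟦ not u ⟧
    one true  = refl
    one false = refl
    total : sum p ≡ good + bad
    total = trans (sym (trans (∫-const p 1) (*-identityʳ (sum p))))
                  (trans (∫-cong p λ x → one (g x)) (∫-+ p _ _))
    double : ∀ s → s + s + 0 ≡ 2 * s
    double = solve-∀

  -- Few edges of E₁ join the two neighbourhoods of a vertex z, so a greedy union U of
  -- such rectangles either shatters E₁ or is small.  If U is small, then the
  -- rectangles {x : (x , y) ∉ U} × N(y) carry few edges of E₂ for most y, and their
  -- greedy union V either shatters E₂ or is small.  If V is small too, then E₃ is
  -- sparse between typical y and z: an edge (y , z) there leaves a quarter of all x
  -- with (x , z) in the rectangle of y but not in V.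
  module TriangleLemma {a b c}
    (E₁ : Fin a → Fin b → Bool) (E₂ : Fin a → Fin c → Bool) (E₃ : Fin b → Fin c → Bool)
    (thin : ∀ x z → sum (λ y → ⟦ E₁ x y ∧ (E₂ x z ∧ E₃ y z) ⟧) ≤ 1)
    (Θ : ℕ) .{{_ : NonZero Θ}}
    where

    -- Read backwards: an edge of `E₃` between typical vertices yields `sx / 4` fresh pairs, so
    -- `D₂ = 4 * Θ` makes `E₃` sparse there. The second family of rectangles is light if each
    -- carries at most a proportion `1 / (D₂ * Θ) = 1 / Ω` of edges. With `D₁ = 4 * Ω`, Markov's
    -- inequality lets at most a quarter of the `y` violate this.
    Ω D₁ D₂ S : ℕ
    Ω  = 4 * Θ * Θ
    D₁ = 4 * Ω
    D₂ = 4 * Θ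
    S  = 2 ^ D₁

    private instance
      Ω≢0 : NonZero Ω
      Ω≢0 = m*n≢0 (4 * Θ) Θ {{m*n≢0 4 Θ}}
      D₁≢0 : NonZero D₁
      D₁≢0 = m*n≢0 4 Ω
      D₂≢0 : NonZero D₂
      D₂≢0 = m*n≢0 4 Θ

    1≤S : 1 ≤ S
    1≤S = m^n>0 2 D₁

    private
      2≤S : 2 ≤ S
      2≤S = ^-monoʳ-≤ 2 (>-nonZero⁻¹ D₁)

      2^D₂≤S : 2 ^ D₂ ≤ S
      2^D₂≤S = ^-monoʳ-≤ 2 (begin
        D₂              ≤⟨ m≤m*n D₂ Θ ⟩
        Ω               ≤⟨ m≤n*m Ω 4 ⟩
        D₁              ∎)
        where open ≤-Reasoning

    module _ (p : Fin a → ℕ) (q : Fin b → ℕ) (r : Fin c → ℕ) (q≤1 : ∀ y → q y ≤ 1)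
             (big : D₁ * Θ ≤ sum q) where

      Outcome : Set
      Outcome = Shatter S Θ E₁ p q ⊎ Shatter S Θ E₂ p r ⊎ Shatter S Θ E₃ q r

      private
        sx sy sz : ℕ
        sx = sum p
        sy = sum q
        sz = sum r

      module First where
        open ≤-Reasoning
        -- By `thin`, each `x` has at most one `E₁`-neighbour `y` inside the rectangle of `z`, which
        -- therefore carries at most `sx` edges. By `big` this is at most `sx * sy / (D₁ * Θ)`.
        light : ∀ z → D₁ * ∬ p q (λ x y → Θ * ⟦ E₁ x y ⟧ * ⟦ E₂ x z ∧ E₃ y z ⟧) ≤ sx * sy
        light z = begin
          D₁ * ∬ p q (λ x y → Θ * ⟦ E₁ x y ⟧ * ⟦ E₂ x z ∧ E₃ y z ⟧)
            ≤⟨ *-monoʳ-≤ D₁ (∫-mono p row) ⟩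
          D₁ * ∫ p (λ _ → Θ)
            ≡⟨ cong (D₁ *_) (∫-const p Θ) ⟩
          D₁ * (sx * Θ)
            ≡⟨ swap D₁ sx Θ ⟩
          sx * (D₁ * Θ)
            ≤⟨ *-monoʳ-≤ sx big ⟩
          sx * sy ∎
          where
          swap : ∀ u v w → u * (v * w) ≡ v * (u * w)
          swap = solve-∀
          row : ∀ x → ∫ q (λ y → Θ * ⟦ E₁ x y ⟧ * ⟦ E₂ x z ∧ E₃ y z ⟧) ≤ Θ
          row x = begin
            ∫ q (λ y → Θ * ⟦ E₁ x y ⟧ * ⟦ E₂ x z ∧ E₃ y z ⟧)
              ≡⟨ ∫-cong q (λ y → trans (*-assoc Θ _ _) (cong (Θ *_) (sym (⟦∧⟧ (E₁ x y) _)))) ⟩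
            ∫ q (λ y → Θ * ⟦ E₁ x y ∧ (E₂ x z ∧ E₃ y z) ⟧)
              ≡⟨ ∫-* q Θ _ ⟩
            Θ * ∫ q (λ y → ⟦ E₁ x y ∧ (E₂ x z ∧ E₃ y z) ⟧)
              ≤⟨ *-monoʳ-≤ Θ (∫-≤-sum q _ q≤1) ⟩
            Θ * sum (λ y → ⟦ E₁ x y ∧ (E₂ x z ∧ E₃ y z) ⟧)
              ≤⟨ *-monoʳ-≤ Θ (thin x z) ⟩
            Θ * 1
              ≡⟨ *-identityʳ Θ ⟩
            Θ ∎

        open Greedy p q (λ x y → Θ * ⟦ E₁ x y ⟧) D₁ (λ z x → E₂ x z) (λ z y → E₃ y z) light public

      weigh : ∀ {a b} (E : Fin a → Fin b → Bool) p q (U : Fin a → Fin b → Bool) →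
              ∬ p q (λ x y → Θ * ⟦ E x y ⟧ * ⟦ U x y ⟧) ≡ Θ * ∬ p q (λ x y → ⟦ E x y ⟧ * ⟦ U x y ⟧)
      weigh E p q U = trans (∬-cong p q λ x y → *-assoc Θ ⟦ E x y ⟧ ⟦ U x y ⟧) (∬-* p q Θ _)

      module Second (sx≢0 : NonZero sx) (sz≢0 : NonZero sz) (U : Fin a → Fin b → Bool)
                    (fresh≤ : ∀ z → D₁ * First.fresh U z ≤ sx * sy)
                    (few : 8 * ∬ p q (λ x y → ⟦ U x y ⟧) ≤ sx * sy) where
        open ≤-Reasoning
        private instance
          _ = sx≢0
          _ = sz≢0
          _ = m*n≢0 sx sz
          _ = m*n≢0 4 sx

        μU : ℕ
        μU = ∬ p q (λ x y → ⟦ U x y ⟧)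

        -- `W[ y ]` is the number of `E₂`-edges in the rectangle that the second greedy union
        -- attaches to a typical `y`.
        U[_] W[_] : Fin b → ℕ
        U[ y ] = ∫ p λ x → ⟦ U x y ⟧
        W[ y ] = ∬ p r λ x z → ⟦ E₂ x z ⟧ * ⟦ not (U x y) ∧ E₃ y z ⟧

        good : Fin b → Bool
        good y = (2 * U[ y ] ≤ᵇ sx) ∧ (Ω * W[ y ] ≤ᵇ sx * sz)

        good-U : ∀ y → ⟦ good y ⟧ * (2 * U[ y ]) ≤ sx
        good-U y with (2 * U[ y ] ≤ᵇ sx) | within-≤ (2 * U[ y ]) sx
        ... | false | _  = z≤n
        ... | true  | le = ≤-trans (*-monoˡ-≤ (2 * U[ y ]) (⟦⟧≤1 ((Ω * W[ y ] ≤ᵇ sx * sz)))) le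

        good-W : ∀ y → ⟦ good y ⟧ * (Ω * W[ y ]) ≤ sx * sz
        good-W y with (2 * U[ y ] ≤ᵇ sx)
        ... | false = z≤n
        ... | true  = within-≤ (Ω * W[ y ]) (sx * sz)

        bad-≤ : ∀ y → sx * sz * ⟦ not (good y) ⟧ ≤ 2 * sz * U[ y ] + Ω * W[ y ]
        bad-≤ y with (2 * U[ y ] ≤ᵇ sx) | within-> (2 * U[ y ]) sx
        ... | true  | _  = ≤-trans (≤-reflexive (*-comm (sx * sz) _))
                             (≤-trans (within-> (Ω * W[ y ]) (sx * sz)) (m≤n+m _ _))
        ... | false | gt = ≤-trans (begin
          sx * sz * 1          ≡⟨ *-identityʳ _ ⟩
          sx * sz              ≡⟨ *-comm sx sz ⟩
          sz * sx              ≤⟨ *-monoʳ-≤ sz (≤-trans (≤-reflexive (sym (+-identityʳ sx))) gt) ⟩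
          sz * (2 * U[ y ])    ≡⟨ swap sz U[ y ] ⟩
          2 * sz * U[ y ]      ∎) (m≤m+n _ _)
          where
          swap : ∀ u v → u * (2 * v) ≡ 2 * u * v
          swap = solve-∀

        -- Both sides count the triples with `E₂ x z`, `E₃ y z` and `(x , y)` outside `U`. This
        -- double counting turns what the first greedy union leaves uncovered, seen from `z`, into
        -- lightness of the second family, seen from `y`.
        ∫W : ∫ q W[_] ≡ ∫ r (First.fresh U)
        ∫W = begin-equality
          ∫ q (λ y → ∫ p λ x → ∫ r λ z → ⟦ E₂ x z ⟧ * ⟦ not (U x y) ∧ E₃ y z ⟧)
            ≡⟨ ∫-comm q p _ ⟩
          ∫ p (λ x → ∫ q λ y → ∫ r λ z → ⟦ E₂ x z ⟧ * ⟦ not (U x y) ∧ E₃ y z ⟧)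
            ≡⟨ ∫-cong p (λ x → ∫-comm q r _) ⟩
          ∫ p (λ x → ∫ r λ z → ∫ q λ y → ⟦ E₂ x z ⟧ * ⟦ not (U x y) ∧ E₃ y z ⟧)
            ≡⟨ ∫-comm p r _ ⟩
          ∫ r (λ z → ∫ p λ x → ∫ q λ y → ⟦ E₂ x z ⟧ * ⟦ not (U x y) ∧ E₃ y z ⟧)
            ≡⟨ ∫-cong r (λ z → ∬-cong p q λ x y → pointwise (E₂ x z) (U x y) (E₃ y z)) ⟩
          ∫ r (First.fresh U) ∎
          where
          pointwise : ∀ e u f → ⟦ e ⟧ * ⟦ not u ∧ f ⟧ ≡ ⟦ (e ∧ f) ∧ not u ⟧
          pointwise true  true  true  = refl
          pointwise true  true  false = refl
          pointwise true  false true  = refl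
          pointwise true  false false = refl
          pointwise false u     f     = refl

        -- Markov's inequality twice: `U` has proportion at most 1/8, so at most a quarter of the
        -- `y` have `U[ y ]` above `sx / 2`; the mean of `W` is at most `sx * sz / D₁`, so at most a
        -- quarter have `W[ y ]` above `sx * sz / Ω`.
        good-majority : sy ≤ 2 * ∫ q (λ y → ⟦ good y ⟧)
        good-majority = majority q good (*-cancelˡ-≤ 2 (*-cancelˡ-≤ (sx * sz) (begin
          sx * sz * (2 * (2 * bad))                               ≡⟨ four (sx * sz) bad ⟩
          4 * (sx * sz * bad)                                     ≡⟨ cong (4 *_) (∫-* q (sx * sz) _) ⟨
          4 * ∫ q (λ y → sx * sz * ⟦ not (good y) ⟧)              ≤⟨ *-monoʳ-≤ 4 (∫-mono q bad-≤) ⟩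
          4 * ∫ q (λ y → 2 * sz * U[ y ] + Ω * W[ y ])            ≡⟨ cong (4 *_) (∫-+ q _ _) ⟩
          4 * (∫ q (λ y → 2 * sz * U[ y ]) + ∫ q (λ y → Ω * W[ y ]))
            ≡⟨ cong (4 *_) (cong₂ _+_ (trans (∫-* q (2 * sz) _) (cong (2 * sz *_) (∫-comm q p _))) (∫-* q Ω _)) ⟩
          4 * (2 * sz * μU + Ω * ∫ q W[_])                        ≡⟨ distribute sz μU Ω (∫ q W[_]) ⟩
          sz * (8 * μU) + 4 * Ω * ∫ q W[_]                        ≡⟨ cong (λ w → sz * (8 * μU) + 4 * Ω * w) ∫W ⟩
          sz * (8 * μU) + 4 * Ω * ∫ r (First.fresh U)             ≤⟨ +-mono-≤ (*-monoʳ-≤ sz few) freshes ⟩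
          sz * (sx * sy) + sz * (sx * sy)                         ≡⟨ collect sx sy sz ⟩
          sx * sz * (2 * sy)                                      ∎)))
          where
          bad : ℕ
          bad = ∫ q (λ y → ⟦ not (good y) ⟧)
          four : ∀ u v → u * (2 * (2 * v)) ≡ 4 * (u * v)
          four = solve-∀
          distribute : ∀ z u o w → 4 * (2 * z * u + o * w) ≡ z * (8 * u) + 4 * o * w
          distribute = solve-∀
          collect : ∀ x y z → z * (x * y) + z * (x * y) ≡ x * z * (2 * y)
          collect = solve-∀
          freshes : 4 * Ω * ∫ r (First.fresh U) ≤ sz * (sx * sy)
          freshes = begin
            D₁ * ∫ r (First.fresh U)             ≡⟨ ∫-* r D₁ _ ⟨
            ∫ r (λ z → D₁ * First.fresh U z)     ≤⟨ ∫-mono r fresh≤ ⟩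
            ∫ r (λ _ → sx * sy)                  ≡⟨ ∫-const r _ ⟩
            sz * (sx * sy)                       ∎

        -- An atypical `y` is given the empty rectangle, so the bound holds for the whole family.
        light : ∀ y → D₂ * ∬ p r (λ x z → Θ * ⟦ E₂ x z ⟧ * ⟦ (good y ∧ not (U x y)) ∧ E₃ y z ⟧) ≤ sx * sz
        light y = begin
          D₂ * ∬ p r (λ x z → Θ * ⟦ E₂ x z ⟧ * ⟦ (good y ∧ not (U x y)) ∧ E₃ y z ⟧)
            ≡⟨ cong (D₂ *_) (∬-cong p r λ x z → pointwise (good y) (not (U x y)) (E₃ y z) ⟦ E₂ x z ⟧) ⟩
          D₂ * ∬ p r (λ x z → ⟦ good y ⟧ * Θ * (⟦ E₂ x z ⟧ * ⟦ not (U x y) ∧ E₃ y z ⟧))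
            ≡⟨ cong (D₂ *_) (∬-* p r (⟦ good y ⟧ * Θ) _) ⟩
          D₂ * (⟦ good y ⟧ * Θ * W[ y ])
            ≡⟨ reorder Θ ⟦ good y ⟧ W[ y ] ⟩
          ⟦ good y ⟧ * (Ω * W[ y ])
            ≤⟨ good-W y ⟩
          sx * sz ∎
          where
          reorder : ∀ t g w → 4 * t * (g * t * w) ≡ g * (4 * t * t * w)
          reorder = solve-∀
          ring₀ : ∀ t e → t * e * 0 ≡ 0
          ring₀ = solve-∀
          ring₁ : ∀ t e u → t * e * u ≡ 1 * t * (e * u)
          ring₁ = solve-∀
          pointwise : ∀ g u f e → Θ * e * ⟦ (g ∧ u) ∧ f ⟧ ≡ ⟦ g ⟧ * Θ * (e * ⟦ u ∧ f ⟧)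
          pointwise false u f e = ring₀ Θ e
          pointwise true  u f e = ring₁ Θ e ⟦ u ∧ f ⟧

        open Greedy p r (λ x z → Θ * ⟦ E₂ x z ⟧) D₂ (λ y x → good y ∧ not (U x y)) E₃ light public

        module Third (V : Fin a → Fin c → Bool) (fresh≤′ : ∀ y → D₂ * fresh V y ≤ sx * sz)
                     (few′ : 8 * ∬ p r (λ x z → ⟦ V x z ⟧) ≤ sx * sz) where

          V[_] : Fin c → ℕ
          V[ z ] = ∫ p λ x → ⟦ V x z ⟧

          good′ : Fin c → Bool
          good′ z = 4 * V[ z ] ≤ᵇ sx

          good′-majority : sz ≤ 2 * ∫ r (λ z → ⟦ good′ z ⟧)
          good′-majority = majority r good′ (*-cancelˡ-≤ sx (begin
            sx * (2 * bad)                             ≡⟨ swap sx bad ⟩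
            2 * (sx * bad)                             ≡⟨ cong (2 *_) (∫-* r sx _) ⟨
            2 * ∫ r (λ z → sx * ⟦ not (good′ z) ⟧)     ≤⟨ *-monoʳ-≤ 2 (∫-mono r λ z →
                ≤-trans (≤-reflexive (*-comm sx _)) (within-> (4 * V[ z ]) sx)) ⟩
            2 * ∫ r (λ z → 4 * V[ z ])                 ≡⟨ cong (2 *_) (trans (∫-* r 4 _) (cong (4 *_) (∫-comm r p _))) ⟩
            2 * (4 * ∬ p r (λ x z → ⟦ V x z ⟧))        ≡⟨ *-assoc 2 4 (∬ p r (λ x z → ⟦ V x z ⟧)) ⟨
            8 * ∬ p r (λ x z → ⟦ V x z ⟧)              ≤⟨ few′ ⟩
            sx * sz                                    ∎))
            where
            bad : ℕ
            bad = ∫ r (λ z → ⟦ not (good′ z) ⟧)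
            swap : ∀ u v → u * (2 * v) ≡ 2 * (u * v)
            swap = solve-∀

          crowded : ∀ y z g h e → ⟦ g ⟧ * (2 * U[ y ]) ≤ sx → ⟦ h ⟧ * (4 * V[ z ]) ≤ sx →
                    sx * (⟦ e ⟧ * ⟦ g ∧ h ⟧) ≤ 4 * ∫ p (λ x → ⟦ ((g ∧ not (U x y)) ∧ e) ∧ not (V x z) ⟧)
          crowded y z g     h     false _ _ = ≤-trans (≤-reflexive (*-zeroʳ sx)) z≤n
          crowded y z false h     true  _ _ = ≤-trans (≤-reflexive (*-zeroʳ sx)) z≤n
          crowded y z true  false true  _ _ = ≤-trans (≤-reflexive (*-zeroʳ sx)) z≤n
          crowded y z true  true  true  gU hV =
            -- At least `sx - sx / 2 - sx / 4` of the `x` avoid both `U` and `V`.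
            linear 0 (+-mono-≤ (+-mono-≤ gU gU) (+-mono-≤ hV (*-monoʳ-≤ 4 cover)))
                   (arith sx U[ y ] V[ z ] (∫ p λ x → ⟦ (not (U x y) ∧ true) ∧ not (V x z) ⟧))
            where
            arith : ∀ s u v f → s * (1 * 1) + (s + s + (s + 4 * (u + v + f))) + 0
                              ≡ 4 * f + (1 * (2 * u) + 1 * (2 * u) + (1 * (4 * v) + 4 * s))
            arith = solve-∀
            one : ∀ u v → 1 ≤ ⟦ u ⟧ + ⟦ v ⟧ + ⟦ (not u ∧ true) ∧ not v ⟧
            one true  v     = s≤s z≤n
            one false true  = s≤s z≤n
            one false false = s≤s z≤n
            cover : sx ≤ U[ y ] + V[ z ] + ∫ p (λ x → ⟦ (not (U x y) ∧ true) ∧ not (V x z) ⟧)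
            cover = begin
              sx            ≡⟨ trans (∫-const p 1) (*-identityʳ sx) ⟨
              ∫ p (λ _ → 1) ≤⟨ ∫-mono p (λ x → one (U x y) (V x z)) ⟩
              ∫ p (λ x → ⟦ U x y ⟧ + ⟦ V x z ⟧ + ⟦ (not (U x y) ∧ true) ∧ not (V x z) ⟧)
                ≡⟨ trans (∫-+ p _ _) (cong (_+ ∫ p (λ x → ⟦ (not (U x y) ∧ true) ∧ not (V x z) ⟧)) (∫-+ p _ _)) ⟩
              U[ y ] + V[ z ] + ∫ p (λ x → ⟦ (not (U x y) ∧ true) ∧ not (V x z) ⟧) ∎

          -- Each edge counted here accounts for at least `sx / 4` pairs of the rectangle of `y`
          -- that are fresh for `V`, and there are at most `sx * sz / (4 * Θ)` such pairs.
          row-sparse : ∀ y → Θ * ∫ r (λ z → ⟦ E₃ y z ⟧ * ⟦ good y ∧ good′ z ⟧) ≤ sz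
          row-sparse y = *-cancelˡ-≤ (4 * sx) (begin
            4 * sx * (Θ * e)              ≡⟨ reorder₁ sx Θ e ⟩
            D₂ * (sx * e)                 ≡⟨ cong (D₂ *_) (∫-* r sx _) ⟨
            D₂ * ∫ r (λ z → sx * (⟦ E₃ y z ⟧ * ⟦ good y ∧ good′ z ⟧))
              ≤⟨ *-monoʳ-≤ D₂ (∫-mono r λ z →
                   crowded y z (good y) (good′ z) (E₃ y z) (good-U y) (within-≤ (4 * V[ z ]) sx)) ⟩
            D₂ * ∫ r (λ z → 4 * ∫ p (λ x → ⟦ ((good y ∧ not (U x y)) ∧ E₃ y z) ∧ not (V x z) ⟧))
              ≡⟨ cong (D₂ *_) (trans (∫-* r 4 _) (cong (4 *_) (∫-comm r p _))) ⟩
            D₂ * (4 * fresh V y)          ≡⟨ reorder₂ D₂ (fresh V y) ⟩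
            4 * (D₂ * fresh V y)          ≤⟨ *-monoʳ-≤ 4 (fresh≤′ y) ⟩
            4 * (sx * sz)                 ≡⟨ *-assoc 4 sx sz ⟨
            4 * sx * sz                   ∎)
            where
            e : ℕ
            e = ∫ r (λ z → ⟦ E₃ y z ⟧ * ⟦ good y ∧ good′ z ⟧)
            reorder₁ : ∀ s t e → 4 * s * (t * e) ≡ 4 * t * (s * e)
            reorder₁ = solve-∀
            reorder₂ : ∀ d f → d * (4 * f) ≡ 4 * (d * f)
            reorder₂ = solve-∀

          shatter : Shatter S Θ E₃ q r
          shatter = record
            { part   = λ y z → good y ∧ good′ z
            ; simple = simple-weaken 2≤S (simple-∪-rectangle good good′ simple-∅)
            ; large  = begin
                sy * sz                          ≤⟨ *-mono-≤ good-majority good′-majority ⟩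
                2 * g * (2 * h)                  ≡⟨ reorder g h ⟩
                4 * (g * h)                      ≡⟨ cong (4 *_) product ⟨
                4 * ∬ q r (λ y z → ⟦ good y ∧ good′ z ⟧) ≤⟨ *-monoˡ-≤ (∬ q r (λ y z → ⟦ good y ∧ good′ z ⟧)) {4} {8} (m≤m+n 4 4) ⟩
                8 * ∬ q r (λ y z → ⟦ good y ∧ good′ z ⟧) ∎
            ; sparse = begin
                Θ * ∬ q r (λ y z → ⟦ E₃ y z ⟧ * ⟦ good y ∧ good′ z ⟧)      ≡⟨ ∫-* q Θ _ ⟨
                ∫ q (λ y → Θ * ∫ r (λ z → ⟦ E₃ y z ⟧ * ⟦ good y ∧ good′ z ⟧)) ≤⟨ ∫-mono q row-sparse ⟩
                ∫ q (λ _ → sz)                                            ≡⟨ ∫-const q sz ⟩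
                sy * sz                                                   ∎
            }
            where
            g h : ℕ
            g = ∫ q (λ y → ⟦ good y ⟧)
            h = ∫ r (λ z → ⟦ good′ z ⟧)
            reorder : ∀ g h → 2 * g * (2 * h) ≡ 4 * (g * h)
            reorder = solve-∀
            product : ∬ q r (λ y z → ⟦ good y ∧ good′ z ⟧) ≡ g * h
            product = begin-equality
              ∬ q r (λ y z → ⟦ good y ∧ good′ z ⟧)    ≡⟨ ∬-cong q r (λ y z → ⟦∧⟧ (good y) (good′ z)) ⟩
              ∬ q r (λ y z → ⟦ good y ⟧ * ⟦ good′ z ⟧) ≡⟨ ∫-cong q (λ y → trans (∫-* r ⟦ good y ⟧ _) (*-comm ⟦ good y ⟧ h)) ⟩
              ∫ q (λ y → h * ⟦ good y ⟧)              ≡⟨ ∫-* q h _ ⟩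
              h * g                                   ≡⟨ *-comm h g ⟩
              g * h                                   ∎

      triangle-shatter : Outcome
      triangle-shatter with sx ≟ 0 | sz ≟ 0
      ... | yes sx≡0 | _        = inj₁ (shatter-null p q 1≤S (cong (_* sy) sx≡0))
      ... | no  _    | yes sz≡0 = inj₂ (inj₁ (shatter-null p r 1≤S (trans (cong (sx *_) sz≡0) (*-zeroʳ sx))))
      ... | no sx≢0  | no  sz≢0 with First.greedy
      ...   | U , sU , νU≤ , fresh≤ with sx * sy ≤? 8 * ∬ p q (λ x y → ⟦ U x y ⟧)
      ...     | yes large = inj₁ (record
        { part = U ; simple = sU ; large = large
        ; sparse = ≤-trans (≤-reflexive (sym (weigh E₁ p q U))) νU≤ })
      ...     | no ≰U with Second.greedy (≢-nonZero sx≢0) (≢-nonZero sz≢0) U fresh≤ (≰⇒≥ ≰U)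
      ...       | V , sV , νV≤ , fresh≤′ with sx * sz ≤? 8 * ∬ p r (λ x z → ⟦ V x z ⟧)
      ...         | yes large = inj₂ (inj₁ (record
        { part = V ; simple = simple-weaken 2^D₂≤S sV ; large = large
        ; sparse = ≤-trans (≤-reflexive (sym (weigh E₂ p r V))) νV≤ }))
      ...         | no ≰V = inj₂ (inj₂ (Second.Third.shatter (≢-nonZero sx≢0) (≢-nonZero sz≢0) U fresh≤ (≰⇒≥ ≰U)
                              V fresh≤′ (≰⇒≥ ≰V)))

  -- The entropy potential and its change under relabelling.

  sum-cells : ∀ {T} (φ : Fin a → Fin T) (ψ : Fin b → Fin T) (F : Fin T → Fin T → Fin a → Fin b → ℕ) →
              sum (λ i → sum λ j → ∬ (fibre φ i) (fibre ψ j) (F i j)) ≡ ∬ 𝟙 𝟙 (λ x y → F (φ x) (ψ y) x y)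
  sum-cells φ ψ F = trans
    (sum-cong-≗ λ i → trans (∫-sum (fibre φ i) (λ j x → ∫ (fibre ψ j) (F i j x)))
                            (∫-cong (fibre φ i) λ x → sum-fibre ψ (λ j → F i j x)))
    (sum-fibre φ λ i x → ∫ 𝟙 λ y → F i (ψ y) x y)

  -- A cell with s pairs and e edges, all labelled k, costs 2^K (s 2^(k-K) + e (K-k)).
  -- The best label has 2^(k-K) about e/s and costs about 2^K e log₂ (s/e): up to
  -- rounding, the total cost is the entropy potential of Fox's proof.
  weight : ℕ → ℕ → Bool → ℕ
  weight K k e = 2 ^ k + ⟦ e ⟧ * ((K ∸ k) * 2 ^ K)

  -- The first Boolean says whether the cell is much denser than its label predicts, in which case
  -- the label rises on all of it. Otherwise the label falls on the nearly empty part, marked by the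
  -- second Boolean, and stays elsewhere.
  move : ℕ → Bool → Bool → ℕ
  move k       true  u = suc k
  move zero    false u = zero
  move (suc k) false u = if u then k else suc k

  module Cell {a b} (E : Fin a → Fin b → Bool) (K : ℕ) (p : Fin a → ℕ) (q : Fin b → ℕ) where

    Q s e : ℕ
    Q = 2 ^ K
    s = sum p * sum q
    e = ∬ p q λ x y → ⟦ E x y ⟧

    cost : (Fin a → Fin b → ℕ) → ℕ
    cost k = ∬ p q λ x y → weight K (k x y) (E x y)

    cost-const : ∀ k → cost (λ _ _ → k) ≡ s * 2 ^ k + e * ((K ∸ k) * Q)
    cost-const k = begin
      cost (λ _ _ → k)
        ≡⟨ ∬-+ p q (λ _ _ → 2 ^ k) (λ x y → ⟦ E x y ⟧ * ((K ∸ k) * Q)) ⟩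
      ∬ p q (λ _ _ → 2 ^ k) + ∬ p q (λ x y → ⟦ E x y ⟧ * ((K ∸ k) * Q))
        ≡⟨ cong₂ _+_ (∬-const p q (2 ^ k))
             (trans (∬-cong p q λ x y → *-comm ⟦ E x y ⟧ _) (∬-* p q ((K ∸ k) * Q) _)) ⟩
      s * 2 ^ k + (K ∸ k) * Q * e
        ≡⟨ cong (s * 2 ^ k +_) (*-comm ((K ∸ k) * Q) e) ⟩
      s * 2 ^ k + e * ((K ∸ k) * Q) ∎
      where open ≡-Reasoning

    -- Raising the label adds `2 ^ k` per pair and saves `Q` per edge; the factor 4 makes the saving
    -- at least four times the price. From `k = K` on, the truncated `K ∸ k` leaves nothing to save.
    dense : ℕ → Bool
    dense k = (k <ᵇ K) ∧ (4 * (2 ^ k * s) ≤ᵇ Q * e)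

    private
      ∸-step : ∀ k → k < K → K ∸ k ≡ suc (K ∸ suc k)
      ∸-step k (s≤s {n = K′} k≤K′) = +-∸-assoc 1 k≤K′

      ∸-step-≤ : ∀ k → K ∸ k ≤ suc (K ∸ suc k)
      ∸-step-≤ k = ≤-trans (suc-pred-≤ (K ∸ k)) (s≤s (≤-reflexive (pred[m∸n]≡m∸[1+n] K k)))
        where
        suc-pred-≤ : ∀ m → m ≤ suc (pred m)
        suc-pred-≤ zero    = z≤n
        suc-pred-≤ (suc m) = ≤-refl

      raise : ∀ k → k < K → 4 * (2 ^ k * s) ≤ Q * e →
              128 * cost (λ _ _ → suc k) + Q * e ≤ 128 * cost (λ _ _ → k) + 4 * s
      raise k k<K d rewrite cost-const k | cost-const (suc k) | ∸-step k k<K =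
        linear (95 * (Q * e) + 4 * s) (*-monoʳ-≤ 32 d) (arith s (2 ^ k) e Q (K ∸ suc k))
        where
        arith : ∀ s P e Q h →
          128 * (s * (2 * P) + e * (h * Q)) + Q * e + 32 * (Q * e) + (95 * (Q * e) + 4 * s)
          ≡ 128 * (s * P + e * ((1 + h) * Q)) + 4 * s + 32 * (4 * (P * s))
        arith = solve-∀

      -- Each pair of `U` saves `2 ^ k`, and each edge in it costs one more `Q`, or nothing where
      -- `K ∸ k` is truncated.
      lower : ∀ k (U : Fin a → Fin b → Bool) →
        cost (λ x y → if U x y then k else suc k) + 2 ^ k * ∬ p q (λ x y → ⟦ U x y ⟧)
        ≤ cost (λ _ _ → suc k) + Q * ∬ p q (λ x y → ⟦ E x y ⟧ * ⟦ U x y ⟧)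
      lower k U = begin
        cost (λ x y → if U x y then k else suc k) + 2 ^ k * ∬ p q (λ x y → ⟦ U x y ⟧)
          ≡⟨ trans (∬-+ p q _ _) (cong (cost (λ x y → if U x y then k else suc k) +_) (∬-* p q (2 ^ k) _)) ⟨
        ∬ p q (λ x y → weight K (if U x y then k else suc k) (E x y) + 2 ^ k * ⟦ U x y ⟧)
          ≤⟨ ∬-mono p q (λ x y → pointwise (E x y) (U x y)) ⟩
        ∬ p q (λ x y → weight K (suc k) (E x y) + Q * (⟦ E x y ⟧ * ⟦ U x y ⟧))
          ≡⟨ trans (∬-+ p q _ _) (cong (cost (λ _ _ → suc k) +_) (∬-* p q Q _)) ⟩
        cost (λ _ _ → suc k) + Q * ∬ p q (λ x y → ⟦ E x y ⟧ * ⟦ U x y ⟧) ∎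
        where
        open ≤-Reasoning
        arith : ∀ P Q h e → P + e * ((1 + h) * Q) + P * 1 ≡ 2 * P + e * (h * Q) + Q * (e * 1)
        arith = solve-∀
        pointwise : ∀ e u → weight K (if u then k else suc k) e + 2 ^ k * ⟦ u ⟧
                          ≤ weight K (suc k) e + Q * (⟦ e ⟧ * ⟦ u ⟧)
        pointwise e false = ≤-trans (≤-reflexive (trans (cong (weight K (suc k) e +_) (*-zeroʳ (2 ^ k)))
                                                        (+-identityʳ _))) (m≤m+n _ _)
        pointwise e true  = ≤-trans
          (+-monoˡ-≤ (2 ^ k * 1) (+-monoʳ-≤ (2 ^ k) (*-monoʳ-≤ ⟦ e ⟧ (*-monoˡ-≤ Q (∸-step-≤ k)))))
          (≤-reflexive (arith (2 ^ k) Q (K ∸ suc k) ⟦ e ⟧))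

      not-dense : ∀ k → dense k ≡ false → Q * e ≤ 4 * (2 ^ k * s)
      not-dense k ≡false with k <ᵇ K | <ᵇ-reflects-< k K
      ... | false | ofⁿ k≮K = ≤-trans (*-mono-≤ (^-monoʳ-≤ 2 (≮⇒≥ k≮K)) (∬-⟦⟧≤ p q E)) (m≤n*m _ 4)
      ... | true  | _ with 4 * (2 ^ k * s) ≤ᵇ Q * e | ≤ᵇ-reflects-≤ (4 * (2 ^ k * s)) (Q * e)
      ...   | false | ofⁿ ≰ = ≰⇒≥ ≰

      dense-≤ : ∀ k → dense k ≡ true → k < K × 4 * (2 ^ k * s) ≤ Q * e
      dense-≤ k ≡true with k <ᵇ K | <ᵇ-reflects-< k K
      ... | true  | ofʸ k<K with 4 * (2 ^ k * s) ≤ᵇ Q * e | ≤ᵇ-reflects-≤ (4 * (2 ^ k * s)) (Q * e)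
      ...   | true | ofʸ ≤ = k<K , ≤

    -- The constants come from lowering `suc k`: 128 times the saving is at least
    -- `16 * 2 ^ k * s - 4 * s` (128 / 8 = 16 and 128 / 32 = 4), while a cell that is not dense has
    -- `Q * e` at most `8 * 2 ^ k * s`. The allowance `4 * s` also covers label 0, which cannot
    -- fall: there `Q * e` is itself at most `4 * s`.
    cost-move : ∀ k (U : Fin a → Fin b → Bool) →
      s ≤ 8 * ∬ p q (λ x y → ⟦ U x y ⟧) → 32 * Q * ∬ p q (λ x y → ⟦ E x y ⟧ * ⟦ U x y ⟧) ≤ s →
      128 * cost (λ x y → move k (dense k) (U x y)) + Q * e ≤ 128 * cost (λ _ _ → k) + 4 * s
    cost-move k U large sparse with dense k in d
    cost-move k U large sparse | true = let k<K , le = dense-≤ k d in raise k k<K le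
    cost-move zero U large sparse | false = +-monoʳ-≤ (128 * cost (λ _ _ → 0))
      (≤-trans (not-dense 0 d) (≤-reflexive (cong (4 *_) (*-identityˡ s))))
    cost-move (suc k) U large sparse | false =
      linear (8 * (2 ^ k * s))
        (+-mono-≤ (+-mono-≤ (*-monoʳ-≤ 128 (lower k U)) (*-monoʳ-≤ (16 * 2 ^ k) large))
                  (+-mono-≤ (*-monoʳ-≤ 4 sparse) (not-dense (suc k) d)))
        (arith (cost (λ x y → if U x y then k else suc k)) (cost (λ _ _ → suc k)) Q e (2 ^ k) s
               (∬ p q (λ x y → ⟦ U x y ⟧)) (∬ p q (λ x y → ⟦ E x y ⟧ * ⟦ U x y ⟧)))
      where
      arith : ∀ c′ c Q e P s μ ε →
        128 * c′ + Q * e + (128 * (c + Q * ε) + 16 * P * (8 * μ) + (4 * s + 4 * (2 * P * s))) + 8 * (P * s)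
        ≡ 128 * c + 4 * s + (128 * (c′ + P * μ) + 16 * P * s + (4 * (32 * Q * ε) + Q * e))
      arith = solve-∀

  module Relabel {a b T} (E : Fin a → Fin b → Bool) (K : ℕ) (φ : Fin a → Fin T) (ψ : Fin b → Fin T)
    (κ : Fin T → Fin T → ℕ) (r : Fin T → Fin T → Bool) (U : Fin T → Fin T → Fin a → Fin b → Bool)
    (shattered : ∀ i j → r i j ≡ true →
       sum (fibre φ i) * sum (fibre ψ j) ≤ 8 * ∬ (fibre φ i) (fibre ψ j) (λ x y → ⟦ U i j x y ⟧) ×
       32 * 2 ^ K * ∬ (fibre φ i) (fibre ψ j) (λ x y → ⟦ E x y ⟧ * ⟦ U i j x y ⟧)
         ≤ sum (fibre φ i) * sum (fibre ψ j))
    where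

    update : Fin T → Fin T → Bool → ℕ
    update i j u = if r i j then move (κ i j) (Cell.dense E K (fibre φ i) (fibre ψ j) (κ i j)) u else κ i j

    totalCost : (Fin a → Fin b → ℕ) → ℕ
    totalCost = Cell.cost E K 𝟙 𝟙

    private
      κ′ : Fin a → Fin b → ℕ
      κ′ x y = update (φ x) (ψ y) (U (φ x) (ψ y) x y)

      before after : Fin T → Fin T → Fin a → Fin b → ℕ
      before i j x y = 128 * weight K (κ i j) (E x y) + 4
      after  i j x y = 128 * weight K (update i j (U i j x y)) (E x y) + 2 ^ K * (⟦ r i j ⟧ * ⟦ E x y ⟧)

      cell-≤ : ∀ i j → ∬ (fibre φ i) (fibre ψ j) (after i j) ≤ ∬ (fibre φ i) (fibre ψ j) (before i j)
      cell-≤ i j = begin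
        ∬ p q (after i j)
          ≡⟨ trans (∬-+ p q _ _) (cong₂ _+_ (∬-* p q 128 _)
               (trans (∬-* p q (2 ^ K) _) (cong (2 ^ K *_) (∬-* p q ⟦ r i j ⟧ _)))) ⟩
        128 * cost (λ x y → update i j (U i j x y)) + 2 ^ K * (⟦ r i j ⟧ * e)
          ≤⟨ step ⟩
        128 * cost (λ _ _ → κ i j) + 4 * s
          ≡⟨ trans (∬-+ p q _ _) (cong₂ _+_ (∬-* p q 128 _) (trans (∬-const p q 4) (*-comm s 4))) ⟨
        ∬ p q (before i j) ∎
        where
        open ≤-Reasoning
        p = fibre φ i
        q = fibre ψ j
        open Cell E K p q
        step : 128 * cost (λ x y → update i j (U i j x y)) + 2 ^ K * (⟦ r i j ⟧ * e)
               ≤ 128 * cost (λ _ _ → κ i j) + 4 * s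
        step with r i j in eq
        ... | false = +-monoʳ-≤ (128 * cost (λ _ _ → κ i j)) (≤-trans (≤-reflexive (*-zeroʳ (2 ^ K))) z≤n)
        ... | true  = ≤-trans
          (+-monoʳ-≤ (128 * cost (λ x y → move (κ i j) (dense (κ i j)) (U i j x y)))
                     (≤-reflexive (cong (2 ^ K *_) (+-identityʳ e))))
          (cost-move (κ i j) (U i j) (proj₁ (shattered i j eq)) (proj₂ (shattered i j eq)))

    relabel-cost :
      128 * totalCost κ′ + 2 ^ K * ∬ 𝟙 𝟙 (λ x y → ⟦ r (φ x) (ψ y) ⟧ * ⟦ E x y ⟧)
      ≤ 128 * totalCost (λ x y → κ (φ x) (ψ y)) + 4 * (a * b)
    relabel-cost = begin
      128 * totalCost κ′ + 2 ^ K * ∬ 𝟙 𝟙 (λ x y → ⟦ r (φ x) (ψ y) ⟧ * ⟦ E x y ⟧)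
        ≡⟨ trans (∬-+ 𝟙 𝟙 _ _) (cong₂ _+_ (∬-* 𝟙 𝟙 128 _) (∬-* 𝟙 𝟙 (2 ^ K) _)) ⟨
      ∬ 𝟙 𝟙 (λ x y → after (φ x) (ψ y) x y)
        ≡⟨ sum-cells φ ψ after ⟨
      sum (λ i → sum λ j → ∬ (fibre φ i) (fibre ψ j) (after i j))
        ≤⟨ sum-mono (λ i → sum-mono (cell-≤ i)) ⟩
      sum (λ i → sum λ j → ∬ (fibre φ i) (fibre ψ j) (before i j))
        ≡⟨ sum-cells φ ψ before ⟩
      ∬ 𝟙 𝟙 (λ x y → before (φ x) (ψ y) x y)
        ≡⟨ trans (∬-+ 𝟙 𝟙 _ _) (cong₂ _+_ (∬-* 𝟙 𝟙 128 _) (trans (∬-const {a} {b} 𝟙 𝟙 4)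
             (trans (cong (_* 4) (cong₂ _*_ (sum-𝟙 a) (sum-𝟙 b))) (*-comm (a * b) 4)))) ⟩
      128 * totalCost (λ x y → κ (φ x) (ψ y)) + 4 * (a * b) ∎
      where open ≤-Reasoning

  -- Refinement of the partition along shattered pairs.

  first : ∀ {T} {X : Set} → (Fin T → Maybe X) → Maybe X
  first {zero}  f = nothing
  first {suc T} f with f zero
  ... | just x  = just x
  ... | nothing = first (f ∘ suc)

  first-just : ∀ {T} {X : Set} (f : Fin T → Maybe X) l → ⟦ is-just (f l) ⟧ ≤ ⟦ is-just (first f) ⟧
  first-just {suc T} f l with f zero in eq
  ... | just x  = ⟦⟧≤1 (is-just (f l))
  first-just {suc T} f zero    | nothing rewrite eq = z≤n
  first-just {suc T} f (suc l) | nothing = first-just (f ∘ suc) l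

  module Code (T S : ℕ) where

    -- A new cell is an old cell together with one class for every cell of each of the two other
    -- vertex sets.
    Code : Set
    Code = Fin (T * (S ^ T * S ^ T))

    encode : Fin T → (Fin T → Fin S) → (Fin T → Fin S) → Code
    encode i f g = combine i (combine (funToFin f) (funToFin g))

    index : Code → Fin T
    index p = quotient (S ^ T * S ^ T) p

    left right : Code → Fin T → Fin S
    left  p = finToFun (quotient (S ^ T) (remainder {T} (S ^ T * S ^ T) p))
    right p = finToFun (remainder {S ^ T} (S ^ T) (remainder {T} (S ^ T * S ^ T) p))

    index-encode : ∀ i f g → index (encode i f g) ≡ i
    index-encode i f g = quotient-combine i _

    left-encode : ∀ i f g j → left (encode i f g) j ≡ f j
    left-encode i f g j = trans
      (cong (λ t → finToFun t j) (trans (cong (quotient (S ^ T)) (remainder-combine i _)) (quotient-combine _ (funToFin g))))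
      (finToFun-funToFin f j)

    right-encode : ∀ i f g j → right (encode i f g) j ≡ g j
    right-encode i f g j = trans
      (cong (λ t → finToFun t j)
        (trans (cong (remainder {S ^ T} (S ^ T)) (remainder-combine i _)) (remainder-combine (funToFin f) (funToFin g))))
      (finToFun-funToFin g j)

  module Refine {a b T S} (1≤S : 1 ≤ S) (E : Fin a → Fin b → Bool) (K : ℕ)
    (φ : Fin a → Fin T) (ψ : Fin b → Fin T) (κ : Fin T → Fin T → ℕ)
    (shatter? : ∀ i j → Maybe (Shatter S (32 * 2 ^ K) E (fibre φ i) (fibre ψ j)))
    where

    private
      Sh : Fin T → Fin T → Set
      Sh i j = Shatter S (32 * 2 ^ K) E (fibre φ i) (fibre ψ j)

      part : ∀ {i j} → Maybe (Sh i j) → Fin a → Fin b → Bool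
      part (just sh) = Shatter.part sh
      part nothing   = λ _ _ → false

      simple : ∀ {i j} (sh : Maybe (Sh i j)) → Simple S (part sh)
      simple (just sh) = Shatter.simple sh
      simple nothing   = simple-weaken 1≤S simple-∅

    hit : Fin T → Fin T → Bool
    hit i j = is-just (shatter? i j)

    private
      U : Fin T → Fin T → Fin a → Fin b → Bool
      U i j = part (shatter? i j)

      module At i j = Simple (simple (shatter? i j))

      shattered : ∀ i j → hit i j ≡ true →
        sum (fibre φ i) * sum (fibre ψ j) ≤ 8 * ∬ (fibre φ i) (fibre ψ j) (λ x y → ⟦ U i j x y ⟧) ×
        32 * 2 ^ K * ∬ (fibre φ i) (fibre ψ j) (λ x y → ⟦ E x y ⟧ * ⟦ U i j x y ⟧)
          ≤ sum (fibre φ i) * sum (fibre ψ j)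
      shattered i j eq with shatter? i j
      ... | just sh = Shatter.large sh , Shatter.sparse sh

      open Relabel E K φ ψ κ hit U shattered

    row : Fin T → Fin T → Fin a → Fin S
    row = At.row

    col : Fin T → Fin T → Fin b → Fin S
    col = At.col

    module _ {T′} (index : Fin T′ → Fin T) (left right : Fin T′ → Fin T → Fin S) where

      relabel : Fin T′ → Fin T′ → ℕ
      relabel p q = update (index p) (index q) (At.cell (index p) (index q) (left p (index q)) (right q (index p)))

      -- Labels of new cells are well defined because, by `fits`, the classes of the two ends decide
      -- whether a pair lies in the part. The decoders are parameters since the three graphs read
      -- different components of the codes.
      relabel-≤ : (φ′ : Fin a → Fin T′) (ψ′ : Fin b → Fin T′) →
        (∀ x → index (φ′ x) ≡ φ x) → (∀ y → index (ψ′ y) ≡ ψ y) →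
        (∀ x j → left (φ′ x) j ≡ row (φ x) j x) → (∀ y i → right (ψ′ y) i ≡ col i (ψ y) y) →
        128 * totalCost (λ x y → relabel (φ′ x) (ψ′ y)) + 2 ^ K * ∬ 𝟙 𝟙 (λ x y → ⟦ hit (φ x) (ψ y) ⟧ * ⟦ E x y ⟧)
        ≤ 128 * totalCost (λ x y → κ (φ x) (ψ y)) + 4 * (a * b)
      relabel-≤ φ′ ψ′ index-φ index-ψ left-φ right-ψ = ≤-trans
        (≤-reflexive (cong (λ t → 128 * t + 2 ^ K * ∬ 𝟙 𝟙 (λ x y → ⟦ hit (φ x) (ψ y) ⟧ * ⟦ E x y ⟧))
          (∬-cong 𝟙 𝟙 λ x y → cong (λ k → weight K k (E x y)) (pointwise x y))))
        relabel-cost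
        where
        decode : ∀ p q {i j u v} → index p ≡ i → index q ≡ j → left p j ≡ u → right q i ≡ v →
                 relabel p q ≡ update i j (At.cell i j u v)
        decode p q refl refl refl refl = refl
        pointwise : ∀ x y → relabel (φ′ x) (ψ′ y) ≡ update (φ x) (ψ y) (U (φ x) (ψ y) x y)
        pointwise x y = trans
          (decode (φ′ x) (ψ′ y) (index-φ x) (index-ψ y) (left-φ x (ψ y)) (right-ψ y (φ x)))
          (cong (update (φ x) (ψ y)) (sym (At.fits (φ x) (ψ y) x y)))

  -- The pairs (x , y) with E₁ x y index a family of triangles (x , y , A x y);
  -- every edge of E₂ and E₃ lies in exactly one of them.
  record Triangles (a b c : ℕ) : Set where
    field
      E₁ : Fin a → Fin b → Bool
      E₂ : Fin a → Fin c → Bool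
      E₃ : Fin b → Fin c → Bool
      A  : Fin a → Fin b → Fin c
      thin   : ∀ x z → sum (λ y → ⟦ E₁ x y ∧ (E₂ x z ∧ E₃ y z) ⟧) ≤ 1
      edges₂ : ∀ x (f : Fin c → ℕ) → sum (λ z → ⟦ E₂ x z ⟧ * f z) ≡ sum (λ y → ⟦ E₁ x y ⟧ * f (A x y))
      edges₃ : ∀ y (f : Fin c → ℕ) → sum (λ z → ⟦ E₃ y z ⟧ * f z) ≡ sum (λ x → ⟦ E₁ x y ⟧ * f (A x y))

    size : ℕ
    size = ∬ 𝟙 𝟙 λ x y → ⟦ E₁ x y ⟧

  record State (a b c T : ℕ) : Set where
    field
      φ : Fin a → Fin T
      ψ : Fin b → Fin T
      χ : Fin c → Fin T
      κ₁ κ₂ κ₃ : Fin T → Fin T → ℕ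

  -- The iterated refinement.

  module Iteration {a b c} (G : Triangles a b c) (K : ℕ) where
    open Triangles G

    private
      Q Θ : ℕ
      Q = 2 ^ K
      Θ = 32 * Q

      instance
        Θ≢0 : NonZero Θ
        Θ≢0 = m*n≢0 32 Q {{_}} {{m^n≢0 2 K}}

    open TriangleLemma E₁ E₂ E₃ thin Θ {{Θ≢0}} public using (S; 1≤S; D₁)
    open TriangleLemma E₁ E₂ E₃ thin Θ {{Θ≢0}} using (triangle-shatter; Outcome)

    pairs : ℕ
    pairs = a * b + a * c + b * c

    potential : ∀ {T} → State a b c T → ℕ
    potential st = Cell.cost E₁ K 𝟙 𝟙 (λ x y → κ₁ (φ x) (ψ y))
                 + Cell.cost E₂ K 𝟙 𝟙 (λ x z → κ₂ (φ x) (χ z))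
                 + Cell.cost E₃ K 𝟙 𝟙 (λ y z → κ₃ (ψ y) (χ z))
      where open State st

    size-via-E₂ : ∀ (f : Fin a → Fin c → ℕ) →
      ∬ 𝟙 𝟙 (λ x z → f x z * ⟦ E₂ x z ⟧) ≡ ∬ 𝟙 𝟙 (λ x y → f x (A x y) * ⟦ E₁ x y ⟧)
    size-via-E₂ f = ∫-cong 𝟙 λ x → begin
      ∫ 𝟙 (λ z → f x z * ⟦ E₂ x z ⟧)         ≡⟨ ∫-𝟙 _ ⟩
      sum (λ z → f x z * ⟦ E₂ x z ⟧)         ≡⟨ sum-cong-≗ (λ z → *-comm (f x z) _) ⟩
      sum (λ z → ⟦ E₂ x z ⟧ * f x z)         ≡⟨ edges₂ x (f x) ⟩
      sum (λ y → ⟦ E₁ x y ⟧ * f x (A x y))   ≡⟨ sum-cong-≗ (λ y → *-comm ⟦ E₁ x y ⟧ _) ⟩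
      sum (λ y → f x (A x y) * ⟦ E₁ x y ⟧)   ≡⟨ ∫-𝟙 _ ⟨
      ∫ 𝟙 (λ y → f x (A x y) * ⟦ E₁ x y ⟧)   ∎
      where open ≡-Reasoning

    size-via-E₃ : ∀ (f : Fin b → Fin c → ℕ) →
      ∬ 𝟙 𝟙 (λ y z → f y z * ⟦ E₃ y z ⟧) ≡ ∬ 𝟙 𝟙 (λ x y → f y (A x y) * ⟦ E₁ x y ⟧)
    size-via-E₃ f = trans (∫-cong 𝟙 λ y → begin
      ∫ 𝟙 (λ z → f y z * ⟦ E₃ y z ⟧)         ≡⟨ ∫-𝟙 _ ⟩
      sum (λ z → f y z * ⟦ E₃ y z ⟧)         ≡⟨ sum-cong-≗ (λ z → *-comm (f y z) _) ⟩
      sum (λ z → ⟦ E₃ y z ⟧ * f y z)         ≡⟨ edges₃ y (f y) ⟩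
      sum (λ x → ⟦ E₁ x y ⟧ * f y (A x y))   ≡⟨ sum-cong-≗ (λ x → *-comm ⟦ E₁ x y ⟧ _) ⟩
      sum (λ x → f y (A x y) * ⟦ E₁ x y ⟧)   ≡⟨ ∫-𝟙 _ ⟨
      ∫ 𝟙 (λ x → f y (A x y) * ⟦ E₁ x y ⟧)   ∎) (∫-comm 𝟙 𝟙 _)
      where open ≡-Reasoning

    grow : ℕ → ℕ
    grow T = T * (S ^ T * S ^ T)

    module Step {T} (st : State a b c T) where
      open State st
      open Code T S

      -- The size condition falls on the `y`-cells because `thin` bounds a number of vertices `y`.
      -- Triangles through small cells are written off: there are at most `a * (T * (D₁ * Θ))` of
      -- them.
      small : Fin T → Bool
      small j = sum (fibre ψ j) <ᵇ D₁ * Θ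

      private
        Sh₁ Sh₂ Sh₃ : Fin T → Fin T → Set
        Sh₁ i j = Shatter S Θ E₁ (fibre φ i) (fibre ψ j)
        Sh₂ i l = Shatter S Θ E₂ (fibre φ i) (fibre χ l)
        Sh₃ j l = Shatter S Θ E₃ (fibre ψ j) (fibre χ l)

        outcome : ∀ i j l → Maybe (Sh₁ i j ⊎ Sh₂ i l ⊎ Sh₃ j l)
        outcome i j l with sum (fibre ψ j) <ᵇ D₁ * Θ | <ᵇ-reflects-< (sum (fibre ψ j)) (D₁ * Θ)
        ... | true  | _      = nothing
        ... | false | ofⁿ ≮ = just (triangle-shatter (fibre φ i) (fibre ψ j) (fibre χ l)
                                     (λ y → ⟦⟧≤1 (does (ψ y Fin.≟ j))) (≮⇒≥ ≮))

        only₁ : ∀ {A B C : Set} → Maybe (A ⊎ B ⊎ C) → Maybe A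
        only₁ (just (inj₁ s)) = just s
        only₁ _               = nothing

        only₂ : ∀ {A B C : Set} → Maybe (A ⊎ B ⊎ C) → Maybe B
        only₂ (just (inj₂ (inj₁ s))) = just s
        only₂ _                      = nothing

        only₃ : ∀ {A B C : Set} → Maybe (A ⊎ B ⊎ C) → Maybe C
        only₃ (just (inj₂ (inj₂ s))) = just s
        only₃ _                      = nothing

        outcome-cases : ∀ i j l → 1 ≤ ⟦ is-just (only₁ (outcome i j l)) ⟧ + ⟦ is-just (only₂ (outcome i j l)) ⟧
                                    + ⟦ is-just (only₃ (outcome i j l)) ⟧ + ⟦ small j ⟧
        outcome-cases i j l with sum (fibre ψ j) <ᵇ D₁ * Θ | <ᵇ-reflects-< (sum (fibre ψ j)) (D₁ * Θ)
        ... | true  | _     = ≤-refl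
        ... | false | ofⁿ ≮ with triangle-shatter (fibre φ i) (fibre ψ j) (fibre χ l)
                                   (λ y → ⟦⟧≤1 (does (ψ y Fin.≟ j))) (≮⇒≥ ≮)
        ...   | inj₁ _        = s≤s z≤n
        ...   | inj₂ (inj₁ _) = s≤s z≤n
        ...   | inj₂ (inj₂ _) = s≤s z≤n

        module R₁ = Refine 1≤S E₁ K φ ψ κ₁ (λ i j → first λ l → only₁ (outcome i j l))
        module R₂ = Refine 1≤S E₂ K φ χ κ₂ (λ i l → first λ j → only₂ (outcome i j l))
        module R₃ = Refine 1≤S E₃ K ψ χ κ₃ (λ j l → first λ i → only₃ (outcome i j l))

        covered : ∀ i j l → 1 ≤ ⟦ R₁.hit i j ⟧ + ⟦ R₂.hit i l ⟧ + ⟦ R₃.hit j l ⟧ + ⟦ small j ⟧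
        covered i j l = ≤-trans (outcome-cases i j l) (+-monoˡ-≤ ⟦ small j ⟧
          (+-mono-≤ (+-mono-≤ (first-just (λ l → only₁ (outcome i j l)) l)
                              (first-just (λ j → only₂ (outcome i j l)) j))
                    (first-just (λ i → only₃ (outcome i j l)) i)))

      refined : State a b c (grow T)
      refined = record
        { φ  = λ x → encode (φ x) (λ j → R₁.row (φ x) j x) (λ l → R₂.row (φ x) l x)
        ; ψ  = λ y → encode (ψ y) (λ i → R₁.col i (ψ y) y) (λ l → R₃.row (ψ y) l y)
        ; χ  = λ z → encode (χ z) (λ i → R₂.col i (χ z) z) (λ j → R₃.col j (χ z) z)
        ; κ₁ = R₁.relabel index left left
        ; κ₂ = R₂.relabel index right left
        ; κ₃ = R₃.relabel index right right
        }

      private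
        g₁ g₂ g₃ few : ℕ
        g₁ = ∬ 𝟙 𝟙 λ x y → ⟦ R₁.hit (φ x) (ψ y) ⟧ * ⟦ E₁ x y ⟧
        g₂ = ∬ 𝟙 𝟙 λ x z → ⟦ R₂.hit (φ x) (χ z) ⟧ * ⟦ E₂ x z ⟧
        g₃ = ∬ 𝟙 𝟙 λ y z → ⟦ R₃.hit (ψ y) (χ z) ⟧ * ⟦ E₃ y z ⟧
        few = ∬ {a} {b} 𝟙 𝟙 λ x y → ⟦ small (ψ y) ⟧ * ⟦ E₁ x y ⟧

        size-≤ : size ≤ g₁ + g₂ + g₃ + few
        size-≤ = begin
          size
            -- The triple of cells containing the triangle `(x , y , A x y)` is covered.
            ≤⟨ ∬-mono 𝟙 𝟙 (λ x y → ≤-trans (≤-reflexive (sym (*-identityˡ ⟦ E₁ x y ⟧)))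
                 (*-monoˡ-≤ ⟦ E₁ x y ⟧ (covered (φ x) (ψ y) (χ (A x y))))) ⟩
          ∬ 𝟙 𝟙 (λ x y → (h₁ x y + h₂ x y + h₃ x y + h₄ x y) * ⟦ E₁ x y ⟧)
            ≡⟨ ∬-cong 𝟙 𝟙 (λ x y → distribute (h₁ x y) (h₂ x y) (h₃ x y) (h₄ x y) ⟦ E₁ x y ⟧) ⟩
          ∬ 𝟙 𝟙 (λ x y → h₁ x y * ⟦ E₁ x y ⟧ + h₂ x y * ⟦ E₁ x y ⟧ + h₃ x y * ⟦ E₁ x y ⟧ + h₄ x y * ⟦ E₁ x y ⟧)
            ≡⟨ trans (∬-+ 𝟙 𝟙 _ _) (cong (_+ few) (trans (∬-+ 𝟙 𝟙 _ _)
                 (cong₂ _+_ (trans (∬-+ 𝟙 𝟙 _ _) (cong (g₁ +_) (sym (size-via-E₂ λ x z → ⟦ R₂.hit (φ x) (χ z) ⟧))))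
                            (sym (size-via-E₃ λ y z → ⟦ R₃.hit (ψ y) (χ z) ⟧))))) ⟩
          g₁ + g₂ + g₃ + few ∎
          where
          open ≤-Reasoning
          h₁ h₂ h₃ h₄ : Fin a → Fin b → ℕ
          h₁ x y = ⟦ R₁.hit (φ x) (ψ y) ⟧
          h₂ x y = ⟦ R₂.hit (φ x) (χ (A x y)) ⟧
          h₃ x y = ⟦ R₃.hit (ψ y) (χ (A x y)) ⟧
          h₄ x y = ⟦ small (ψ y) ⟧
          distribute : ∀ u v w t e → (u + v + w + t) * e ≡ u * e + v * e + w * e + t * e
          distribute = solve-∀

        few-≤ : few ≤ a * (T * (D₁ * Θ))
        few-≤ = begin
          few
            ≤⟨ ∬-mono 𝟙 𝟙 (λ x y → ≤-trans (*-monoʳ-≤ ⟦ small (ψ y) ⟧ (⟦⟧≤1 (E₁ x y)))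
                 (≤-reflexive (*-identityʳ ⟦ small (ψ y) ⟧))) ⟩
          ∬ {a} 𝟙 𝟙 (λ _ y → ⟦ small (ψ y) ⟧)
            ≡⟨ trans (∫-const 𝟙 _) (cong (_* ∫ 𝟙 (λ y → ⟦ small (ψ y) ⟧)) (sum-𝟙 a)) ⟩
          a * ∫ 𝟙 (λ y → ⟦ small (ψ y) ⟧)
            ≡⟨ cong (a *_) (sum-fibre ψ (λ j _ → ⟦ small j ⟧)) ⟨
          a * sum (λ j → ∫ (fibre ψ j) (λ _ → ⟦ small j ⟧))
            ≤⟨ *-monoʳ-≤ a (sum-mono λ j → ≤-trans (≤-reflexive (∫-const (fibre ψ j) ⟦ small j ⟧)) (small-≤ j)) ⟩
          a * sum {T} (λ _ → D₁ * Θ)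
            ≡⟨ cong (a *_) (sum-const T (D₁ * Θ)) ⟩
          a * (T * (D₁ * Θ)) ∎
          where
          open ≤-Reasoning
          small-≤ : ∀ j → sum (fibre ψ j) * ⟦ small j ⟧ ≤ D₁ * Θ
          small-≤ j with sum (fibre ψ j) <ᵇ D₁ * Θ | <ᵇ-reflects-< (sum (fibre ψ j)) (D₁ * Θ)
          ... | true  | ofʸ < = ≤-trans (≤-reflexive (*-identityʳ _)) (<⇒≤ <)
          ... | false | _     = ≤-trans (≤-reflexive (*-zeroʳ (sum (fibre ψ j)))) z≤n

        refined-≤ : 128 * potential refined + Q * (g₁ + g₂ + g₃) ≤ 128 * potential st + 4 * pairs
        refined-≤ = linear 0
          (+-mono-≤ (+-mono-≤
            (R₁.relabel-≤ index left left (State.φ refined) (State.ψ refined)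
              (λ x → index-encode _ _ _) (λ y → index-encode _ _ _) (λ x j → left-encode (φ x) _ _ j) (λ y i → left-encode (ψ y) _ _ i))
            (R₂.relabel-≤ index right left (State.φ refined) (State.χ refined)
              (λ x → index-encode _ _ _) (λ z → index-encode _ _ _) (λ x l → right-encode (φ x) _ _ l) (λ z i → left-encode (χ z) _ _ i)))
            (R₃.relabel-≤ index right right (State.ψ refined) (State.χ refined)
              (λ y → index-encode _ _ _) (λ z → index-encode _ _ _) (λ y l → right-encode (ψ y) _ _ l) (λ z j → right-encode (χ z) _ _ j)))
          (arith (Cell.cost E₁ K 𝟙 𝟙 (λ x y → State.κ₁ refined (State.φ refined x) (State.ψ refined y)))
                 (Cell.cost E₂ K 𝟙 𝟙 (λ x z → State.κ₂ refined (State.φ refined x) (State.χ refined z)))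
                 (Cell.cost E₃ K 𝟙 𝟙 (λ y z → State.κ₃ refined (State.ψ refined y) (State.χ refined z)))
                 (Cell.cost E₁ K 𝟙 𝟙 (λ x y → κ₁ (φ x) (ψ y)))
                 (Cell.cost E₂ K 𝟙 𝟙 (λ x z → κ₂ (φ x) (χ z)))
                 (Cell.cost E₃ K 𝟙 𝟙 (λ y z → κ₃ (ψ y) (χ z)))
                 Q g₁ g₂ g₃ (a * b) (a * c) (b * c))
          where
          arith : ∀ u v w u′ v′ w′ Q g h k x y z →
            128 * (u + v + w) + Q * (g + h + k)
              + (128 * u′ + 4 * x + (128 * v′ + 4 * y) + (128 * w′ + 4 * z)) + 0
            ≡ 128 * (u′ + v′ + w′) + 4 * (x + y + z)
              + (128 * u + Q * g + (128 * v + Q * h) + (128 * w + Q * k))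
          arith = solve-∀

      -- Small cells lose at most a quarter of `size`, and the error `4 * pairs` is at most a
      -- quarter of `Q * size`. Half of `Q * size` remains as a gain in 128 potentials, all of it in
      -- 256.
      potential-drop : 16 * pairs ≤ Q * size → 4 * (a * (T * (D₁ * Θ))) ≤ size →
                       256 * potential refined + Q * size ≤ 256 * potential st
      potential-drop pairs≤ cells≤ = *-cancelˡ-≤ 2 (linear 0
        (+-mono-≤ (+-mono-≤ (*-monoʳ-≤ 4 refined-≤) (*-monoʳ-≤ (4 * Q) size-≤))
                  (+-mono-≤ (*-monoʳ-≤ Q (≤-trans (*-monoʳ-≤ 4 few-≤) cells≤)) pairs≤))
        (arith (potential refined) (potential st) Q size pairs (g₁ + g₂ + g₃) few))
        where
        arith : ∀ u v Q m s g f →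
          2 * (256 * u + Q * m) + (4 * (128 * v + 4 * s) + 4 * Q * (g + f) + (Q * m + Q * m)) + 0
          ≡ 2 * (256 * v) + (4 * (128 * u + Q * g) + 4 * Q * m + (Q * (4 * f) + 16 * s))
        arith = solve-∀

    cells : ℕ → ℕ
    cells zero    = 1
    cells (suc j) = grow (cells j)

    -- The potential is at first at most (3 K + 1/16) 2^K size, and each step lowers
    -- it by at least 2^K size / 256.
    steps : ℕ
    steps = 768 * K + 17

    private
      initial : State a b c 1
      initial = record { φ = λ _ → zero ; ψ = λ _ → zero ; χ = λ _ → zero
                     ; κ₁ = λ _ _ → 0 ; κ₂ = λ _ _ → 0 ; κ₃ = λ _ _ → 0 }

      cost-initial : ∀ {a b} (E : Fin a → Fin b → Bool) → ∬ 𝟙 𝟙 (λ x y → 1 * ⟦ E x y ⟧) ≡ size →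
                   Cell.cost E K 𝟙 𝟙 (λ _ _ → 0) ≡ a * b + size * (K * Q)
      cost-initial {a} {b} E eq = trans (Cell.cost-const E K 𝟙 𝟙 0)
        (cong₂ _+_ (trans (*-identityʳ _) (cong₂ _*_ (sum-𝟙 a) (sum-𝟙 b)))
                   (cong (_* (K * Q)) (trans (∬-cong 𝟙 𝟙 λ x y → sym (*-identityˡ ⟦ E x y ⟧)) eq)))

      via₁ : ∬ 𝟙 𝟙 (λ x y → 1 * ⟦ E₁ x y ⟧) ≡ size
      via₁ = ∬-cong 𝟙 𝟙 λ x y → *-identityˡ ⟦ E₁ x y ⟧

      potential-initial : potential initial ≡ pairs + 3 * (size * (K * Q))
      potential-initial = trans
        (cong₂ _+_ (cong₂ _+_ (cost-initial E₁ via₁) (cost-initial E₂ (trans (size-via-E₂ λ _ _ → 1) via₁)))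
                   (cost-initial E₃ (trans (size-via-E₃ λ _ _ → 1) via₁)))
        (arith (a * b) (a * c) (b * c) (size * (K * Q)))
        where
        arith : ∀ x y z w → x + w + (y + w) + (z + w) ≡ x + y + z + 3 * w
        arith = solve-∀

    module _ (pairs≤ : 16 * pairs ≤ Q * size)
             (cells≤ : ∀ j → j < steps → 4 * (a * (cells j * (D₁ * Θ))) ≤ size) where

      private
        iterate : ∀ j → j ≤ steps → ∃[ st ] 256 * potential {cells j} st + j * (Q * size) ≤ 256 * potential initial
        iterate zero    _   = initial , ≤-reflexive (+-identityʳ _)
        iterate (suc j) j<  with iterate j (<⇒≤ j<)
        ... | st , le = Step.refined st , (begin
          256 * potential (Step.refined st) + (Q * size + j * (Q * size))
            ≡⟨ +-assoc (256 * potential (Step.refined st)) (Q * size) _ ⟨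
          256 * potential (Step.refined st) + Q * size + j * (Q * size)
            ≤⟨ +-monoˡ-≤ (j * (Q * size)) (Step.potential-drop st pairs≤ (cells≤ j j<)) ⟩
          256 * potential st + j * (Q * size)
            ≤⟨ le ⟩
          256 * potential initial ∎)
          where open ≤-Reasoning

      -- The potential never becomes negative, so `steps * (Q * size)` is at most 256 times its
      -- initial value, that is, at most `(768 * K + 16) * (Q * size)`. As `steps` exceeds that
      -- factor by one, `Q * size` vanishes.
      size≡0 : size ≡ 0
      size≡0 = m*n≡0⇒m≡0 size Q {{m^n≢0 2 K}} (n≤0⇒n≡0 (linear 0
        (+-mono-≤ (≤-trans total (≤-reflexive (cong (256 *_) potential-initial)))
                  (*-monoʳ-≤ 16 pairs≤))
        (arith size K Q pairs)))
        where
        total : steps * (Q * size) ≤ 256 * potential initial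
        total = let st , le = iterate steps ≤-refl
                in ≤-trans (m≤n+m (steps * (Q * size)) (256 * potential st)) le
        arith : ∀ m K Q s → m * Q + (256 * (s + 3 * (m * (K * Q))) + 16 * (Q * m)) + 0
                          ≡ 0 + ((768 * K + 17) * (Q * m) + 16 * (16 * s))
        arith = solve-∀

  -- Towers, the iterated logarithm and the choice of parameters.

  tower : ℕ → ℕ
  tower zero    = 1
  tower (suc h) = 2 ^ tower h

  *-^ : ∀ x y q → (x * y) ^ q ≡ x ^ q * y ^ q
  *-^ x y zero    = refl
  *-^ x y (suc q) = trans (cong (x * y *_) (*-^ x y q)) (interchange x y (x ^ q) (y ^ q))
    where
    interchange : ∀ x y u v → x * y * (u * v) ≡ x * u * (y * v)
    interchange = solve-∀

  n<2^n : ∀ n → n < 2 ^ n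
  n<2^n zero    = z<s
  n<2^n (suc n) = ≤-trans (s<s (n<2^n n)) (+-mono-≤ (m^n>0 2 n) (m≤m+n (2 ^ n) 0))

  n<tower : ∀ h → h < tower h
  n<tower zero    = z<s
  n<tower (suc h) = ≤-<-trans (n<tower h) (n<2^n (tower h))

  tower-mono : ∀ {g h} → g ≤ h → tower g ≤ tower h
  tower-mono {h = h} z≤n  = ≤-trans (s≤s z≤n) (n<tower h)
  tower-mono (s≤s g≤h)    = ^-monoʳ-≤ 2 (tower-mono g≤h)

  tower<-log*-acc : ∀ n (ac : Acc _<_ n) h → h < log*-acc n ac → tower h < n
  tower<-log*-acc (suc (suc n)) (acc rec) zero    _       = s<s z<s
  tower<-log*-acc (suc (suc n)) (acc rec) (suc h) (s≤s h<) = ≰⇒> λ n≤ →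
    <⇒≱ (tower<-log*-acc ⌈log₂ 2 + n ⌉ (rec (⌈log₂⌉-< n)) h h<)
        (≤-trans (⌈log₂⌉-mono-≤ n≤) (≤-reflexive (⌈log₂2^n⌉≡n (tower h))))

  tower<-log* : ∀ n h → h < log* n → tower h < n
  tower<-log* n = tower<-log*-acc n (<-wellFounded n)

  -- The shift by 7 is forced: at 6 the inequality reads 78 ≤ 64.
  quadratic≤2^ : ∀ k → (7 + k) + 2 * ((7 + k) * (7 + k)) ≤ 2 ^ (7 + k)
  quadratic≤2^ zero    = ≤ᵇ⇒≤ _ _ _
  quadratic≤2^ (suc k) = linear (2 * (k * k) + 25 * k + 74) (*-monoʳ-≤ 2 (quadratic≤2^ k)) (arith k (2 ^ (7 + k)))
    where
    arith : ∀ k P → (8 + k) + 2 * ((8 + k) * (8 + k)) + 2 * P + (2 * (k * k) + 25 * k + 74)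
                  ≡ 2 * P + 2 * ((7 + k) + 2 * ((7 + k) * (7 + k)))
    arith = solve-∀

  quadratic-≤ : ∀ {m} → 7 ≤ m → m + 2 * (m * m) ≤ 2 ^ m
  quadratic-≤ {m} 7≤m = subst (λ m → m + 2 * (m * m) ≤ 2 ^ m) (m+[n∸m]≡n 7≤m) (quadratic≤2^ (m ∸ 7))

  -- One refinement thus climbs two levels of the tower: the number of cells becomes at most
  -- `2 ^ (B + 2 * (B * B))`.
  grow-≤ : ∀ {D T B} → 7 ≤ B → D ≤ B → T ≤ B → T * ((2 ^ D) ^ T * (2 ^ D) ^ T) ≤ 2 ^ (2 ^ B)
  grow-≤ {D} {T} {B} 7≤B D≤B T≤B = begin
    T * ((2 ^ D) ^ T * (2 ^ D) ^ T)   ≤⟨ *-mono-≤ (<⇒≤ (n<2^n T)) (*-mono-≤ pow pow) ⟩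
    2 ^ T * (2 ^ (B * B) * 2 ^ (B * B))
      ≡⟨ trans (cong (2 ^ T *_) (sym (^-distribˡ-+-* 2 (B * B) (B * B)))) (sym (^-distribˡ-+-* 2 T _)) ⟩
    2 ^ (T + (B * B + B * B))         ≤⟨ ^-monoʳ-≤ 2 (+-mono-≤ T≤B (≤-reflexive (cong (B * B +_) (sym (+-identityʳ (B * B)))))) ⟩
    2 ^ (B + 2 * (B * B))             ≤⟨ ^-monoʳ-≤ 2 (quadratic-≤ 7≤B) ⟩
    2 ^ (2 ^ B)                       ∎
    where
    open ≤-Reasoning
    pow : (2 ^ D) ^ T ≤ 2 ^ (B * B)
    pow = ≤-trans (≤-reflexive (^-*-assoc 2 D T)) (^-monoʳ-≤ 2 (*-mono-≤ D≤B T≤B))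

  quartic-≤ : ∀ {u v w t B} → 7 ≤ B → u ≤ B → v ≤ B → w ≤ B → t ≤ B → u * (v * w * t) ≤ 2 ^ (2 ^ B)
  quartic-≤ {u} {v} {w} {t} {B} 7≤B u≤ v≤ w≤ t≤ = begin
    u * (v * w * t)
      ≤⟨ *-mono-≤ (exp u≤) (*-mono-≤ (*-mono-≤ (exp v≤) (exp w≤)) (exp t≤)) ⟩
    2 ^ B * (2 ^ B * 2 ^ B * 2 ^ B)
      ≡⟨ cong (2 ^ B *_) (trans (cong (_* 2 ^ B) (sym (^-distribˡ-+-* 2 B B))) (sym (^-distribˡ-+-* 2 (B + B) B))) ⟩
    2 ^ B * 2 ^ (B + B + B)
      ≡⟨ ^-distribˡ-+-* 2 B (B + B + B) ⟨
    2 ^ (B + (B + B + B))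
      ≤⟨ ^-monoʳ-≤ 2 (≤-trans (+-monoʳ-≤ B three) (quadratic-≤ 7≤B)) ⟩
    2 ^ (2 ^ B) ∎
    where
    open ≤-Reasoning
    exp : ∀ {u} → u ≤ B → u ≤ 2 ^ B
    exp u≤ = ≤-trans u≤ (<⇒≤ (n<2^n B))
    three : B + B + B ≤ 2 * (B * B)
    three = begin
      B + B + B    ≡⟨ arith B ⟩
      3 * B        ≤⟨ *-monoˡ-≤ B (≤-trans (s≤s (s≤s (s≤s z≤n))) 7≤B) ⟩
      B * B        ≤⟨ m≤n*m (B * B) 2 ⟩
      2 * (B * B)  ∎
      where
      arith : ∀ B → B + B + B ≡ 3 * B
      arith = solve-∀

  module Bound {n N} (G : Triangles n n N) (κ : ℕ) where
    open Triangles G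
    open Iteration G (2 * κ)

    -- `D₁ = 2 ^ (14 + 4 * κ)` lies below the tower of height `15 + 4 * κ`, and each refinement adds
    -- two levels.
    height : ℕ
    height = 15 + 4 * κ + 2 * steps

    private
      Q Θ : ℕ
      Q = 2 ^ (2 * κ)
      Θ = 32 * Q

      Q≡ : 2 ^ κ * 2 ^ κ ≡ Q
      Q≡ = trans (sym (^-distribˡ-+-* 2 κ κ)) (cong (λ e → 2 ^ (κ + e)) (sym (+-identityʳ κ)))

      D₁≤tower : D₁ ≤ tower (15 + 4 * κ)
      D₁≤tower = begin
        D₁                        ≡⟨ arith Q ⟩
        2 ^ 14 * (Q * Q)          ≡⟨ cong (2 ^ 14 *_) (^-distribˡ-+-* 2 (2 * κ) (2 * κ)) ⟨
        2 ^ 14 * 2 ^ (2 * κ + 2 * κ) ≡⟨ cong (λ e → 2 ^ 14 * 2 ^ e) (four κ) ⟩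
        2 ^ 14 * 2 ^ (4 * κ)      ≡⟨ ^-distribˡ-+-* 2 14 (4 * κ) ⟨
        2 ^ (14 + 4 * κ)          ≤⟨ ^-monoʳ-≤ 2 (<⇒≤ (n<tower (14 + 4 * κ))) ⟩
        tower (15 + 4 * κ)        ∎
        where
        open ≤-Reasoning
        arith : ∀ Q → 4 * (4 * (32 * Q) * (32 * Q)) ≡ 16384 * (Q * Q)
        arith = solve-∀
        four : ∀ κ → 2 * κ + 2 * κ ≡ 4 * κ
        four = solve-∀

      D₁≤ : ∀ j → D₁ ≤ tower (15 + 4 * κ + 2 * j)
      D₁≤ j = ≤-trans D₁≤tower (tower-mono {15 + 4 * κ} {15 + 4 * κ + 2 * j} (m≤m+n (15 + 4 * κ) (2 * j)))

      7≤ : ∀ j → 7 ≤ tower (15 + 4 * κ + 2 * j)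
      7≤ j = ≤-trans (m≤m+n 7 _) (<⇒≤ (n<tower (15 + 4 * κ + 2 * j)))

      cells-≤ : ∀ j → cells j ≤ tower (15 + 4 * κ + 2 * j)
      cells-≤ zero    = ≤-trans (s≤s z≤n) (7≤ 0)
      cells-≤ (suc j) = subst (λ h → cells (suc j) ≤ tower h) (shift (15 + 4 * κ) j)
        (grow-≤ (7≤ j) (D₁≤ j) (cells-≤ j))
        where
        shift : ∀ h j → 2 + (h + 2 * j) ≡ h + 2 * (1 + j)
        shift = solve-∀

      Θ≤D₁ : Θ ≤ D₁
      Θ≤D₁ = ≤-trans (m≤n*m Θ (16 * Θ) {{m*n≢0 16 Θ {{_}} {{m*n≢0 32 Q {{_}} {{m^n≢0 2 (2 * κ)}}}}}})
                     (≤-reflexive (arith Θ))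
        where
        arith : ∀ t → 16 * t * t ≡ 4 * (4 * t * t)
        arith = solve-∀

      2^κ≤D₁ : 2 ^ κ ≤ D₁
      2^κ≤D₁ = ≤-trans (^-monoʳ-≤ 2 (m≤n*m κ 2)) (≤-trans (m≤n*m Q 32) Θ≤D₁)

      cells*-≤ : ∀ j → j ≤ steps → cells j * (D₁ * Θ * 2 ^ κ) ≤ tower (2 + height)
      cells*-≤ j j≤ = quartic-≤ (7≤ steps)
        (≤-trans (cells-≤ j) (tower-mono (+-monoʳ-≤ (15 + 4 * κ) (*-monoʳ-≤ 2 j≤))))
        (D₁≤ steps) (≤-trans Θ≤D₁ (D₁≤ steps)) (≤-trans 2^κ≤D₁ (D₁≤ steps))

    -- If the bound failed, the iteration would show that there is no triangle at all. `K = 2 * κ`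
    -- since one factor `2 ^ κ` is lost to `N / n` and one to `n * n / size`; 48 is 16 for each of
    -- the three pairs of vertex sets.
    size-≤ : N ≤ n * 2 ^ κ → tower (2 + height) ≤ n → size * 2 ^ κ ≤ 48 * (n * n)
    size-≤ N≤ tower≤ = ≮⇒≥ λ big → n≮0 (subst (λ m → 48 * (n * n) < m * 2 ^ κ) (size≡0 (pairs≤ (<⇒≤ big)) (cells≤ (<⇒≤ big))) big)
      where
      open ≤-Reasoning
      module _ (big : 48 * (n * n) ≤ size * 2 ^ κ) where
        P : ℕ
        P = 2 ^ κ
        pairs≤ : 16 * pairs ≤ Q * size
        pairs≤ = begin
          16 * (n * n + n * N + n * N)
            ≤⟨ *-monoʳ-≤ 16 (+-mono-≤ (+-mono-≤ (*-monoʳ-≤ n (m≤m*n n P {{m^n≢0 2 κ}})) (*-monoʳ-≤ n N≤)) (*-monoʳ-≤ n N≤)) ⟩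
          16 * (n * (n * P) + n * (n * P) + n * (n * P))
            ≡⟨ arith₁ n P ⟩
          48 * (n * n) * P
            ≤⟨ *-monoˡ-≤ P big ⟩
          size * P * P
            ≡⟨ arith₂ size P ⟩
          P * P * size
            ≡⟨ cong (_* size) Q≡ ⟩
          Q * size ∎
          where
          arith₁ : ∀ n P → 16 * (n * (n * P) + n * (n * P) + n * (n * P)) ≡ 48 * (n * n) * P
          arith₁ = solve-∀
          arith₂ : ∀ m P → m * P * P ≡ P * P * m
          arith₂ = solve-∀
        cells≤ : ∀ j → j < steps → 4 * (n * (cells j * (D₁ * Θ))) ≤ size
        cells≤ j j< = *-cancelʳ-≤ _ size P {{m^n≢0 2 κ}} (begin
          4 * (n * (cells j * (D₁ * Θ))) * P    ≡⟨ arith n (cells j) (D₁ * Θ) P ⟩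
          4 * (n * (cells j * (D₁ * Θ * P)))    ≤⟨ *-monoʳ-≤ 4 (*-monoʳ-≤ n (≤-trans (cells*-≤ j (<⇒≤ j<)) tower≤)) ⟩
          4 * (n * n)                           ≤⟨ *-monoˡ-≤ (n * n) (m≤m+n 4 44) ⟩
          48 * (n * n)                          ≤⟨ big ⟩
          size * P                              ∎)
          where
          arith : ∀ n c d P → 4 * (n * (c * d)) * P ≡ 4 * (n * (c * (d * P)))
          arith = solve-∀

  -- Bound is applied with κ = ⌊log* n / q⌋ + 1; for κ ≥ 2, 6204 is the least q for
  -- which its tower, of height 3076 κ + 51, is guaranteed to be at most n.
  power-bound : ∀ {n N} (G : Triangles n n N) q .{{_ : NonZero q}} → 6204 ≤ q →
    N ^ q ≤ n ^ q * 2 ^ log* n →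
    Triangles.size G ^ q * 2 ^ log* n ≤ (48 * (n * n)) ^ q
  power-bound {n} {N} G q 6204≤q N^q≤ = bound (L / q) refl
    where
    open ≤-Reasoning
    open Triangles G using (size)
    L : ℕ
    L = log* n

    L≤ : L ≤ suc (L / q) * q
    L≤ = begin
      L                    ≡⟨ m≡m%n+[m/n]*n L q ⟩
      L % q + L / q * q    ≤⟨ +-monoˡ-≤ (L / q * q) (<⇒≤ (m%n<n L q)) ⟩
      q + L / q * q        ∎

    size≤n² : size ≤ n * n
    size≤n² = ≤-trans (∬-⟦⟧≤ 𝟙 𝟙 (Triangles.E₁ G)) (≤-reflexive (cong₂ _*_ (sum-𝟙 n) (sum-𝟙 n)))

    raise : ∀ {x y} κ → L ≤ κ * q → x * 2 ^ κ ≤ y → x ^ q * 2 ^ L ≤ y ^ q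
    raise {x} {y} κ L≤κq le = begin
      x ^ q * 2 ^ L          ≤⟨ *-monoʳ-≤ (x ^ q) (^-monoʳ-≤ 2 L≤κq) ⟩
      x ^ q * 2 ^ (κ * q)    ≡⟨ cong (x ^ q *_) (^-*-assoc 2 κ q) ⟨
      x ^ q * (2 ^ κ) ^ q    ≡⟨ *-^ x (2 ^ κ) q ⟨
      (x * 2 ^ κ) ^ q        ≤⟨ ^-monoˡ-≤ q le ⟩
      y ^ q                  ∎

    bound : ∀ κ₀ → L / q ≡ κ₀ → size ^ q * 2 ^ L ≤ (48 * (n * n)) ^ q
    -- For `κ = 1` the trivial bound `size ≤ n * n` suffices.
    bound zero    eq = raise 1 (≤-trans L≤ (≤-reflexive (cong (λ k → suc k * q) eq))) (begin
      size * 2            ≤⟨ *-monoˡ-≤ 2 size≤n² ⟩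
      n * n * 2           ≡⟨ *-comm (n * n) 2 ⟩
      2 * (n * n)         ≤⟨ *-monoˡ-≤ (n * n) (m≤m+n 2 46) ⟩
      48 * (n * n)        ∎)
    bound (suc k) eq = raise κ L≤κq (Bound.size-≤ G κ N≤ (<⇒≤ (tower<-log* n _ height<)))
      where
      κ : ℕ
      κ = 2 + k
      L≤κq : L ≤ κ * q
      L≤κq = ≤-trans L≤ (≤-reflexive (cong (λ k → suc k * q) eq))
      N≤ : N ≤ n * 2 ^ κ
      N≤ = ≮⇒≥ λ N> → <⇒≱ (^-monoˡ-< q N>) (begin
        N ^ q                  ≤⟨ N^q≤ ⟩
        n ^ q * 2 ^ L          ≤⟨ raise κ L≤κq ≤-refl ⟩
        (n * 2 ^ κ) ^ q        ∎)
      arith : ∀ k → 3 + (15 + 4 * (2 + k) + 2 * (768 * (2 * (2 + k)) + 17)) + 3128 * k ≡ 6204 * (1 + k)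
      arith = solve-∀
      height< : 2 + Bound.height G κ < L
      height< = begin-strict
        2 + Bound.height G κ      <⟨ ≤-trans (m≤m+n _ (3128 * k)) (≤-reflexive (arith k)) ⟩
        6204 * suc k              ≤⟨ *-monoˡ-≤ (suc k) 6204≤q ⟩
        q * suc k                 ≡⟨ trans (*-comm q (suc k)) (cong (_* q) (sym eq)) ⟩
        L / q * q                 ≤⟨ m/n*n≤m L q ⟩
        L                         ∎

  -- Triangles from a cylinder intersection.

  some : (Fin a → Bool) → Bool
  some {zero}  f = false
  some {suc a} f = f zero ∨ some (f ∘ suc)

  some-true : ∀ (f : Fin a → Bool) → some f ≡ true → ∃[ i ] f i ≡ true
  some-true {suc a} f eq with f zero in f0
  ... | true  = zero , f0
  ... | false = let i , fi = some-true (f ∘ suc) eq in suc i , fi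

  AtMostOne : (Fin a → Bool) → Set
  AtMostOne f = ∀ i j → f i ≡ true → f j ≡ true → i ≡ j

  sum-AtMostOne : ∀ (f : Fin a → Bool) → AtMostOne f → sum (λ i → ⟦ f i ⟧) ≡ ⟦ some f ⟧
  sum-AtMostOne {zero}  f u = refl
  sum-AtMostOne {suc a} f u with f zero in f0
  ... | false = sum-AtMostOne (f ∘ suc) λ i j fi fj → Fin.suc-injective (u (suc i) (suc j) fi fj)
  ... | true  = cong suc (trans (sum-cong-≗ none) (trans (sum-const a 0) (*-zeroʳ a)))
    where
    none : ∀ i → ⟦ f (suc i) ⟧ ≡ 0
    none i with f (suc i) in fi
    ... | false = refl
    ... | true with () ← u zero (suc i) f0 fi

  ∧-true : ∀ p q → p ∧ q ≡ true → p ≡ true × q ≡ true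
  ∧-true true true refl = refl , refl

  ≟-true : ∀ (i j : Fin a) → does (i Fin.≟ j) ≡ true → i ≡ j
  ≟-true i j eq with i Fin.≟ j
  ... | yes i≡j = i≡j

  image : (Fin a → Fin b) → (Fin a → Bool) → Fin b → Bool
  image g e z = some λ y → does (g y Fin.≟ z) ∧ e y

  image-true : ∀ (g : Fin a → Fin b) e z → image g e z ≡ true → ∃[ y ] g y ≡ z × e y ≡ true
  image-true g e z eq with some-true (λ y → does (g y Fin.≟ z) ∧ e y) eq
  ... | y , eq′ with ∧-true (does (g y Fin.≟ z)) (e y) eq′
  ...   | gy≟z , ey = y , ≟-true (g y) z gy≟z , ey

  sum-image : ∀ (g : Fin a → Fin b) (e : Fin a → Bool) → (∀ {y y′} → g y ≡ g y′ → y ≡ y′) → ∀ (f : Fin b → ℕ) →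
              sum (λ z → ⟦ image g e z ⟧ * f z) ≡ sum (λ y → ⟦ e y ⟧ * f (g y))
  sum-image g e inj f = begin
    sum (λ z → ⟦ image g e z ⟧ * f z)
      ≡⟨ sum-cong-≗ (λ z → cong (_* f z) (sum-AtMostOne _ (unique z))) ⟨
    sum (λ z → sum (λ y → ⟦ does (g y Fin.≟ z) ∧ e y ⟧) * f z)
      ≡⟨ sum-cong-≗ (λ z → *-distribʳ-sum (f z) (λ y → ⟦ does (g y Fin.≟ z) ∧ e y ⟧)) ⟩
    sum (λ z → sum λ y → ⟦ does (g y Fin.≟ z) ∧ e y ⟧ * f z)
      ≡⟨ ∑-comm (λ z y → ⟦ does (g y Fin.≟ z) ∧ e y ⟧ * f z) ⟩
    sum (λ y → sum λ z → ⟦ does (g y Fin.≟ z) ∧ e y ⟧ * f z)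
      ≡⟨ sum-cong-≗ (λ y → sum-cong-≗ λ z → split (does (g y Fin.≟ z)) (e y) (f z)) ⟩
    sum (λ y → sum λ z → ⟦ does (g y Fin.≟ z) ⟧ * (⟦ e y ⟧ * f z))
      ≡⟨ sum-cong-≗ (λ y → sum-δ (g y) (λ z → ⟦ e y ⟧ * f z)) ⟩
    sum (λ y → ⟦ e y ⟧ * f (g y)) ∎
    where
    open ≡-Reasoning
    split : ∀ p q k → ⟦ p ∧ q ⟧ * k ≡ ⟦ p ⟧ * (⟦ q ⟧ * k)
    split true  q k = sym (+-identityʳ (⟦ q ⟧ * k))
    split false q k = refl
    unique : ∀ z → AtMostOne (λ y → does (g y Fin.≟ z) ∧ e y)
    unique z y y′ eq eq′ = inj (trans
      (≟-true (g y) z (proj₁ (∧-true (does (g y Fin.≟ z)) (e y) eq)))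
      (sym (≟-true (g y′) z (proj₁ (∧-true (does (g y′ Fin.≟ z)) (e y′) eq′)))))

  sum-↑ : ∀ k {l} (f : Fin (k + l) → ℕ) → sum f ≡ sum (λ i → f (i ↑ˡ l)) + sum (λ j → f (k ↑ʳ j))
  sum-↑ zero    f = refl
  sum-↑ (suc k) f = trans (cong (f zero +_) (sum-↑ k (f ∘ suc))) (sym (+-assoc (f zero) _ _))

  sum-combine : ∀ k {l} (f : Fin (k * l) → ℕ) → sum f ≡ sum {k} (λ i → sum {l} λ j → f (combine i j))
  sum-combine zero        f = refl
  sum-combine (suc k) {l} f = trans (sum-↑ l f)
    (cong (sum (λ i → f (i ↑ˡ (k * l))) +_) (sum-combine k (λ i → f (l ↑ʳ i))))

  ∣_∣≡sum : ∀ (p : Subset a) → ∣ p ∣ ≡ sum (λ i → ⟦ lookup p i ⟧)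
  ∣ [] ∣≡sum          = refl
  ∣ inside  ∷ p ∣≡sum = cong suc ∣ p ∣≡sum
  ∣ outside ∷ p ∣≡sum = ∣ p ∣≡sum

  module _ {n N} (L : Linjection n N) where
    open Linjection L using (to; row-injective; col-injective)
    open Box n n N

    module _ (S : Subset₃) (S-int : IsCylinderIntersection S) (S⊆ : S ⊆f⁻¹1[ graph L ]) where

      private
        T₁ T₂ T₃ : Subset₃
        T₁ = proj₁ S-int
        T₂ = proj₁ (proj₂ S-int)
        T₃ = proj₁ (proj₂ (proj₂ S-int))

        cyl₁ : IsCylinder₁ T₁
        cyl₁ = let _ , _ , _ , c₁ , _ = S-int in c₁
        cyl₂ : IsCylinder₂ T₂
        cyl₂ = let _ , _ , _ , _ , c₂ , _ = S-int in c₂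
        cyl₃ : IsCylinder₃ T₃
        cyl₃ = let _ , _ , _ , _ , _ , c₃ , _ = S-int in c₃
        S≡ : S ≡ T₁ ∩ T₂ ∩ T₃
        S≡ = let _ , _ , _ , _ , _ , _ , eq = S-int in eq

        S-split : ∀ {i} → i ∈ S → i ∈ T₁ × i ∈ T₂ × i ∈ T₃
        S-split i∈S = let ∈T₁ , ∈T₂₃ = x∈p∩q⁻ T₁ (T₂ ∩ T₃) (subst (_ ∈_) S≡ i∈S)
                      in ∈T₁ , x∈p∩q⁻ T₂ T₃ ∈T₂₃

        S-join : ∀ {i} → i ∈ T₁ → i ∈ T₂ → i ∈ T₃ → i ∈ S
        S-join ∈T₁ ∈T₂ ∈T₃ = subst (_ ∈_) (sym S≡) (x∈p∩q⁺ (∈T₁ , x∈p∩q⁺ (∈T₂ , ∈T₃)))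

        on-graph : ∀ {x y z} → cell x y z ∈ S → to x y ≡ z
        on-graph {x} {y} {z} ∈S = ≟-true (to x y) z (S⊆ x y z ∈S)

        E : Fin n → Fin n → Bool
        E x y = lookup S (cell x y (to x y))

        ∈-E : ∀ x y → E x y ≡ true → cell x y (to x y) ∈ S
        ∈-E x y = lookup⇒[]= (cell x y (to x y)) S

        E₂ E₃ : Fin n → Fin N → Bool
        E₂ x = image (to x) (E x)
        E₃ y = image (λ x → to x y) (λ x → E x y)

        -- The edge `E₃ y z` comes from a point `(x′ , y , z)` of `S`, which puts `(x , y , z)` into
        -- `T₁`. Likewise `E₂ x z` puts it into `T₂` and `E x y` into `T₃`. So it lies in `S`, hence
        -- on the graph: every triangle is one of the given family.
        closed : ∀ x y z → E x y ∧ (E₂ x z ∧ E₃ y z) ≡ true → to x y ≡ z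
        closed x y z eq with ∧-true (E x y) _ eq
        ... | e₁ , eq′ with ∧-true (E₂ x z) (E₃ y z) eq′
        ...   | e₂ , e₃ with image-true (to x) (E x) z e₂ | image-true (λ x → to x y) (λ x → E x y) z e₃
        ...     | y′ , refl , ey′ | x′ , x′≡ , ex′ = on-graph (S-join
          (cyl₁ x′ x y _ (proj₁ (S-split (subst (λ z → cell x′ y z ∈ S) x′≡ (∈-E x′ y ex′)))))
          (cyl₂ x y′ y _ (proj₁ (proj₂ (S-split (∈-E x y′ ey′)))))
          (cyl₃ x y _ _ (proj₂ (proj₂ (S-split (∈-E x y e₁))))))

      triangles : Triangles n n N
      triangles = record
        { E₁ = E ; E₂ = E₂ ; E₃ = E₃ ; A = to
        -- By `closed` all such `y` have `to x y` equal to `z`, and rows are injective.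
        ; thin   = λ x z → ≤-trans (≤-reflexive (sum-AtMostOne _ λ y y′ eq eq′ →
                     row-injective x (trans (closed x y z eq) (sym (closed x y′ z eq′)))))
                     (⟦⟧≤1 (some λ y → E x y ∧ (E₂ x z ∧ E₃ y z)))
        ; edges₂ = λ x → sum-image (to x) (E x) (row-injective x)
        ; edges₃ = λ y → sum-image (λ x → to x y) (λ x → E x y) (col-injective y)
        }

      ∣S∣≤size : ∣ S ∣ ≤ Triangles.size triangles
      ∣S∣≤size = begin
        ∣ S ∣
          ≡⟨ ∣ S ∣≡sum ⟩
        sum (λ i → ⟦ lookup S i ⟧)
          ≡⟨ trans (sum-combine n _) (sum-cong-≗ {n} λ x → sum-combine n _) ⟩
        sum {n} (λ x → sum {n} λ y → sum {N} λ z → ⟦ lookup S (cell x y z) ⟧)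
          ≤⟨ sum-mono {n} (λ x → sum-mono {n} λ y → sum-mono {N} λ z → on-graph-≤ x y z) ⟩
        sum {n} (λ x → sum {n} λ y → sum {N} λ z → ⟦ does (to x y Fin.≟ z) ⟧ * ⟦ E x y ⟧)
          ≡⟨ sum-cong-≗ {n} (λ x → sum-cong-≗ {n} λ y → sum-δ (to x y) (λ _ → ⟦ E x y ⟧)) ⟩
        sum {n} (λ x → sum {n} λ y → ⟦ E x y ⟧)
          ≡⟨ trans (∫-𝟙 {n} _) (sum-cong-≗ {n} λ x → ∫-𝟙 {n} _) ⟨
        Triangles.size triangles ∎
        where
        open ≤-Reasoning
        on-graph-≤ : ∀ x y z → ⟦ lookup S (cell x y z) ⟧ ≤ ⟦ does (to x y Fin.≟ z) ⟧ * ⟦ E x y ⟧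
        on-graph-≤ x y z with lookup S (cell x y z) in eq
        ... | false = z≤n
        ... | true with on-graph (lookup⇒[]= (cell x y z) S eq)
        ...   | refl rewrite eq | dec-true (to x y Fin.≟ to x y) refl = ≤-refl

    -- The maximum is either its default 0 or the cardinality of an admissible set, which is at most
    -- the size of a family of triangles; hence the closure conditions on `P`.
    α₃-all : (P : ℕ → Set) → P 0 → (∀ {i j} → i ≤ j → P j → P i) →
             (∀ (G : Triangles n n N) → P (Triangles.size G)) → P (α₃ L)
    α₃-all P P0 down sizes = argmax-all (λ x → x) {P = P} P0 (map⁺ (All.map
      (λ {S} (int , S⊆) → down (∣S∣≤size S int S⊆) (sizes (triangles S int S⊆)))
      (all-filter (admissible? (graph L)) (subsets _))))

open import Data.Integer as ℤ using (+_)
import Data.Integer.Properties as ℤ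
open import Data.Nat as ℕ using (ℕ; zero; suc; NonZero; _^_; z≤n)
open import Data.Nat.Coprimality as Coprime using (1-coprimeTo)
import Data.Nat.Properties as ℕ
open import Data.Rational as ℚ using (ℚ; 0ℚ; mkℚ; _<_; _*_)
import Data.Rational.Properties as ℚ

open Combinatorics using (power-bound; α₃-all)

-- Passage to the rational statement.

fromℕ-mkℚ : ∀ n → fromℕ n ≡ mkℚ (+ n) 0 (Coprime.sym (1-coprimeTo n))
fromℕ-mkℚ n = ℚ.normalize-coprime (Coprime.sym (1-coprimeTo n))

fromℕ-* : ∀ m n → fromℕ m * fromℕ n ≡ fromℕ (m ℕ.* n)
fromℕ-* m n rewrite fromℕ-mkℚ m | fromℕ-mkℚ n = cong (ℚ._/ 1) (sym (ℤ.pos-* m n))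

fromℕ-^ : ∀ m k → fromℕ m ^ℚ k ≡ fromℕ (m ^ k)
fromℕ-^ m zero    = refl
fromℕ-^ m (suc k) = trans (cong (fromℕ m *_) (fromℕ-^ m k)) (fromℕ-* m (m ^ k))

fromℕ-mono : ∀ {m n} → m ℕ.≤ n → fromℕ m ℚ.≤ fromℕ n
fromℕ-mono {m} {n} m≤n rewrite fromℕ-mkℚ m | fromℕ-mkℚ n =
  ℚ.*≤* (ℤ.*-monoʳ-≤-nonNeg (+ 1) (ℤ.+≤+ m≤n))

fromℕ-reflects : ∀ {m n} → fromℕ m ℚ.≤ fromℕ n → m ℕ.≤ n
fromℕ-reflects {m} {n} le rewrite fromℕ-mkℚ m | fromℕ-mkℚ n =
  ℤ.drop‿+≤+ (ℤ.*-cancelʳ-≤-pos (+ m) (+ n) (+ 1) (ℚ.drop-*≤* le))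

α₃-bound : ∀ {n N} q .{{_ : NonZero q}} → 6204 ℕ.≤ q → N ^ q ℕ.≤ n ^ q ℕ.* 2 ^ log* n →
           (A : Linjection n N) → α₃ A ^ q ℕ.* 2 ^ log* n ℕ.≤ (48 ℕ.* n ^ 2) ^ q
α₃-bound {n} q@(suc _) 6204≤q N≤ A = α₃-all A (λ m → m ^ q ℕ.* 2 ^ log* n ℕ.≤ (48 ℕ.* n ^ 2) ^ q)
  z≤n (λ i≤j → ℕ.≤-trans (ℕ.*-monoˡ-≤ (2 ^ log* n) (ℕ.^-monoˡ-≤ q i≤j)))
  (λ G → ℕ.≤-trans (power-bound G q 6204≤q N≤)
    (ℕ.≤-reflexive (cong (λ s → (48 ℕ.* s) ^ q) (cong (n ℕ.*_) (sym (ℕ.*-identityʳ n))))))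

-- With numerator 1, both relations are inequalities between `suc d`-th powers of natural numbers,
-- with the factor `2 ^ log* n`.
theorem-for : ∀ d → 6204 ℕ.≤ suc d →
  let c = mkℚ (+ 1) d (1-coprimeTo (suc d)) in
  0ℚ < c × 0ℚ < fromℕ 48 ×
    (∀ (n N : ℕ) .{{_ : NonZero n}} .{{_ : NonZero N}} →
    fromℕ N ≤ fromℕ n ·2^[ c · log* n ] →
    (A : Linjection n N) →
    fromℕ (α₃ A) ≤ fromℕ 48 * fromℕ (n ^ 2) /2^[ c · log* n ])
theorem-for d 6204≤ = ℚ.positive⁻¹ _ , ℚ.positive⁻¹ _ , λ n N N≤ A →
  let q = suc d
      l = 1 ℕ.* log* n
      l≡ = ℕ.*-identityˡ (log* n)
      upper = trans (cong (_* fromℕ (2 ^ l)) (fromℕ-^ n q)) (fromℕ-* (n ^ q) (2 ^ l))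
      lower = trans (cong (_* fromℕ (2 ^ l)) (fromℕ-^ (α₃ A) q)) (fromℕ-* (α₃ A ^ q) (2 ^ l))
      right = trans (cong (_^ℚ q) (fromℕ-* 48 (n ^ 2))) (fromℕ-^ (48 ℕ.* n ^ 2) q)
      N^q≤  = fromℕ-reflects (subst₂ ℚ._≤_ (fromℕ-^ N q) upper N≤)
  in subst₂ ℚ._≤_ (sym lower) (sym right) (fromℕ-mono
       (subst (λ l → α₃ A ^ q ℕ.* 2 ^ l ℕ.≤ (48 ℕ.* n ^ 2) ^ q) (sym l≡)
         (α₃-bound q 6204≤ (subst (λ l → N ^ q ℕ.≤ n ^ q ℕ.* 2 ^ l) l≡ N^q≤) A)))

theorem32 : ∃[ c ] ∃[ C ] 0ℚ < c × 0ℚ < C ×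
    (∀ (n N : ℕ) .{{_ : NonZero n}} .{{_ : NonZero N}} →
    fromℕ N ≤ fromℕ n ·2^[ c · log* n ] →
    (A : Linjection n N) →
    fromℕ (α₃ A) ≤ C * fromℕ (n ^ 2) /2^[ c · log* n ])
-- `mkℚ` takes the predecessor of the denominator, so `c` is 1/6204 and `C` is 48.
theorem32 = _ , _ , theorem-for 6203 ℕ.≤-refl
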